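{- Let $P$ be a spiral on $n$ nodes with $k=O(\log n)$ turning points $(tp_1,\dots,tp_k)$, $tp_1$ being the internal and $tp_k$ the external endpoint. Then in the connectivity graph model $P$ can be grown from a single node placed at $tp_k$ in $O(\log n)$ time steps.
   Context: Shapes. Grid points are integer pairs $(x,y)$; two grid points are adjacent if they are at orthogonal (Manhattan) distance $1$. A shape $S=(V,E)$ is a finite connected graph whose nodes occupy distinct grid points and whose edges join only pairs of nodes occupying adjacent points; shapes are considered up to translation, and $n=|V|$. Growth operations. One node, the anchor $u_0$, is stationary; other nodes move relative to it, and a tree is rooted at $u_0$. A growth operation on a node $u$ toward an adjacent grid point $p$ either (i) if $u$ has no edge to $p$, creates a new node $u'$ at $p$ with edge $uu'$; or (ii) if $p$ is occupied by a node $v$ with $uv\in E$, creates a new node $u'$ at $p$, replaces edge $uv$ by edges $uu',u'v$, and translates by one unit, along the axis of $uv$, the part of the tree hanging from whichever of $u,v$ is farther from $u_0$, away from the other endpoint. In one time step a set of operations is applied concurrently, each node receiving at most one operation and all operations having the same cardinal direction; the displacement of each node is the sum of the unit vectors contributed by the operations on its path to $u_0$. The set is collision-free if no two nodes collide during these motions or end at the same point. Growth processes (connectivity graph model). A growth process from an initial shape $S_0$ performs time steps $t=1,2,\dots$, each applying a collision-free set of growth operations to the current shape; no edges are deleted and no edges are created other than by the operations. It grows $S$ from $S_0$ in $t_f$ time steps if the shape obtained after step $t_f$ is $S$. Paths and spirals. For a path $P=(u_1,\dots,u_n)$, $u_i$ is a turning point if $i\in\{1,n\}$ or $u_{i-1}u_i\perp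 u_iu_{i+1}$. A spiral is a path whose turning points, ordered from one endpoint to the other, follow consecutive cardinal directions in a single rotational sense (always clockwise or always counterclockwise). A single spiral winds outward without self-intersection from an internal endpoint $tp_1$ to an external endpoint $tp_k$; segment $s_i$ joins $tp_i$ and $tp_{i+1}$. -}

module Defs where

open import Level using (0ℓ)
open import Data.Empty using (⊥)
open import Data.Fin using (Fin; zero; suc; toℕ; fromℕ; fromℕ<)
open import Data.Fin.Properties using (any?; toℕ-fromℕ<; toℕ<n; fromℕ<-toℕ)
open import Data.Fin.Subset using (Subset; _∈_)
open import Data.Fin.Subset.Properties using (_∈?_)
open import Data.Integer using (ℤ; +_; -_; 0ℤ; 1ℤ; -1ℤ; ∣_∣; _+_; _-_; _*_; _<_)
import Data.Integer.Properties as ℤₚ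
open import Data.List using (List; filter; allFin)
import Data.Nat as ℕ
open import Data.Nat using (ℕ; NonZero)
import Data.Nat.Properties as ℕₚ
open import Data.Product using (∃; ∃₂; _×_; _,_)
open import Data.Product.Properties using (≡-dec)
open import Data.Sum using (_⊎_; inj₁; inj₂; swap)
open import Function.Bundles using (_↔_; _⇔_; Inverse)
open import Function.Definitions using (Injective)
open import Relation.Binary.Core using (Rel)
open import Relation.Binary.Definitions using (Symmetric; DecidableEquality)
open import Relation.Binary.Construct.Closure.ReflexiveTransitive using (Star; ε; _◅_; _◅◅_; reverse)
open import Relation.Binary.PropositionalEquality using (_≡_; _≢_; refl; sym; trans; cong; cong₂; subst)
open import Relation.Nullary using (¬_; Dec; yes; no)
open import Relation.Nullary.Decidable using (_×-dec_; _⊎-dec_)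

Point : Set
Point = ℤ × ℤ

origin : Point
origin = 0ℤ , 0ℤ

infixl 6 _⊕_ _⊖_
infixl 7 _·_

_⊕_ : Point → Point → Point
(x , y) ⊕ (x′ , y′) = x + x′ , y + y′

_⊖_ : Point → Point → Point
(x , y) ⊖ (x′ , y′) = x - x′ , y - y′

_·_ : ℤ → Point → Point
a · (x , y) = a * x , a * y

dot : Point → Point → ℤ
dot (x , y) (x′ , y′) = x * x′ + y * y′

_≟ᴾ_ : DecidableEquality Point
_≟ᴾ_ = ≡-dec ℤₚ._≟_ ℤₚ._≟_

Adjacent : Rel Point 0ℓ
Adjacent (x , y) (x′ , y′) = ∣ x - x′ ∣ ℕ.+ ∣ y - y′ ∣ ≡ 1

data Direction : Set where
  north east south west : Direction

unit : Direction → Point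
unit north = 0ℤ , 1ℤ
unit east  = 1ℤ , 0ℤ
unit south = 0ℤ , -1ℤ
unit west  = -1ℤ , 0ℤ

record Shape : Set₁ where
  field
    size          : ℕ
    pos           : Fin size → Point
    Edge          : Rel (Fin size) 0ℓ
    pos-injective : Injective _≡_ _≡_ pos
    edge-sym      : Symmetric Edge
    edge-adjacent : ∀ {u v} → Edge u v → Adjacent (pos u) (pos v)
    connected     : ∀ u v → Star Edge u v

record AnchoredShape : Set₁ where
  field
    shape  : Shape
  open Shape shape public
  field
    anchor : Fin size

-- All operations of a time step share the direction `d` and each node
-- receives at most one, so a set of operations is `d` with a set `Q` of nodes.
module Operations (S : AnchoredShape) (d : Direction) (Q : Subset (AnchoredShape.size S)) where
  open AnchoredShape S

  -- For an edge uv: the operation on `u` is of kind (ii), along this edge.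
  Inserts : Rel (Fin size) 0ℓ
  Inserts u v = u ∈ Q × pos v ≡ pos u ⊕ unit d

  Split : Rel (Fin size) 0ℓ
  Split u v = Inserts u v ⊎ Inserts v u

  inserts? : ∀ u v → Dec (Inserts u v)
  inserts? u v = (u ∈? Q) ×-dec (pos v ≟ᴾ (pos u ⊕ unit d))

  split? : ∀ u v → Dec (Split u v)
  split? u v = inserts? u v ⊎-dec inserts? v u

  -- The unit vector that an edge uv, traversed away from the anchor (so that
  -- `v` is the farther endpoint), contributes to everything hanging from `v`.
  contribution : Fin size → Fin size → Point
  contribution u v with split? u v
  ... | yes _ = pos v ⊖ pos u
  ... | no  _ = origin

  contributions : ∀ {u v} → Star Edge u v → Point
  contributions ε = origin
  contributions (_◅_ {u} {v} _ w) = contribution u v ⊕ contributions w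

  -- In a tree, backtracking parts of a walk contribute opposite vectors, so
  -- every walk from the anchor to `v` has the same sum as the path.
  IsDisplacement : (Fin size → Point) → Set
  IsDisplacement δ = ∀ {v} (w : Star Edge anchor v) → δ v ≡ contributions w

  -- `inj₂ (u , _)` is the node created by the operation on `u`.
  Node : Set
  Node = Fin size ⊎ ∃ (_∈ Q)

  -- In kind (ii), whichever of u, v moves, the created node ends up between
  -- them, hence at one unit in direction `d` from the final point of `u`.
  newPos : (Fin size → Point) → Node → Point
  newPos δ (inj₁ u)       = pos u ⊕ δ u
  newPos δ (inj₂ (u , _)) = pos u ⊕ δ u ⊕ unit d

  data NewEdge : Rel Node 0ℓ where
    kept     : ∀ {u v} → Edge u v → ¬ Split u v → NewEdge (inj₁ u) (inj₁ v)
    near     : ∀ {u} (q : u ∈ Q) → NewEdge (inj₁ u) (inj₂ (u , q))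
    near-sym : ∀ {u} (q : u ∈ Q) → NewEdge (inj₂ (u , q)) (inj₁ u)
    far      : ∀ {u v} (q : u ∈ Q) → Edge u v → pos v ≡ pos u ⊕ unit d →
               NewEdge (inj₂ (u , q)) (inj₁ v)
    far-sym  : ∀ {u v} (q : u ∈ Q) → Edge u v → pos v ≡ pos u ⊕ unit d →
               NewEdge (inj₁ v) (inj₂ (u , q))

  -- Nodes move at constant speed during one unit of time.  `no-meeting` says
  -- that pos u + τ δ u ≢ pos v + τ δ v for every τ = a / b in [0,1]; as all
  -- vectors are integral, a meeting time, if there is one, can be taken
  -- rational.  A created node emerges from the node operated on, so it meets
  -- another node on the way only if two old nodes meet or two final points
  -- coincide.
  record CollisionFree (δ : Fin size → Point) : Set where
    field
      no-meeting    : ∀ {u v} → u ≢ v → ∀ (a b : ℕ) → .{{NonZero b}} → a ℕ.≤ b →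
                      (+ b) · pos u ⊕ (+ a) · δ u ≢ (+ b) · pos v ⊕ (+ a) · δ v
      distinct-ends : Injective _≡_ _≡_ (newPos δ)

-- `S′` is the result of one time step from `S`, up to a relabelling of the nodes.
-- Positions are absolute: the anchor keeps its point.
record Step (S S′ : AnchoredShape) : Set where
  private
    module S  = AnchoredShape S
    module S′ = AnchoredShape S′
  field
    direction : Direction
    operated  : Subset S.size
  open Operations S direction operated public
  field
    δ               : Fin S.size → Point
    δ-displacement  : IsDisplacement δ
    collisionFree   : CollisionFree δ
    relabel         : Node ↔ Fin S′.size
  open Inverse relabel using (to)
  field
    preserves-pos    : ∀ x → S′.pos (to x) ≡ newPos δ x
    preserves-edge   : ∀ x y → NewEdge x y ⇔ S′.Edge (to x) (to y)
    preserves-anchor : to (inj₁ S.anchor) ≡ S′.anchor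

data GrowsIn : ℕ → AnchoredShape → AnchoredShape → Set₁ where
  done : ∀ {S} → GrowsIn 0 S S
  step : ∀ {t S S′ S″} → Step S S′ → GrowsIn t S′ S″ → GrowsIn (ℕ.suc t) S S″

singleNode : Point → AnchoredShape
singleNode p = record
  { shape = record
    { size          = 1
    ; pos           = λ _ → p
    ; Edge          = λ _ _ → ⊥
    ; pos-injective = λ { {zero} {zero} _ → refl }
    ; edge-sym      = λ ()
    ; edge-adjacent = λ ()
    ; connected     = λ { zero zero → ε }
    }
  ; anchor = zero
  }

Next : ∀ {n} → Rel (Fin n) 0ℓ
Next i j = toℕ j ≡ ℕ.suc (toℕ i)

record Path (n : ℕ) : Set where
  field
    node           : Fin n → Point
    node-injective : Injective _≡_ _≡_ node
    next-adjacent  : ∀ {i j} → Next i j → Adjacent (node i) (node j)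

  Bend : Fin n → Fin n → Fin n → Set
  Bend h i j = Next h i × Next i j × dot (node i ⊖ node h) (node j ⊖ node i) ≡ 0ℤ

  TurningPoint : Fin n → Set
  TurningPoint i = toℕ i ≡ 0 ⊎ ℕ.suc (toℕ i) ≡ n ⊎ ∃₂ λ h j → Bend h i j

  turningPoint? : ∀ i → Dec (TurningPoint i)
  turningPoint? i =
    (toℕ i ℕₚ.≟ 0) ⊎-dec (ℕ.suc (toℕ i) ℕₚ.≟ n) ⊎-dec
    any? λ h → any? λ j →
      (toℕ i ℕₚ.≟ ℕ.suc (toℕ h)) ×-dec (toℕ j ℕₚ.≟ ℕ.suc (toℕ i)) ×-dec
      (dot (node i ⊖ node h) (node j ⊖ node i) ℤₚ.≟ 0ℤ)

  turningPoints : List (Fin n)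
  turningPoints = filter turningPoint? (allFin n)

Adjacent-sym : Symmetric Adjacent
Adjacent-sym {x , y} {x′ , y′} =
  trans (cong₂ ℕ._+_ (ℤₚ.∣i-j∣≡∣j-i∣ x′ x) (ℤₚ.∣i-j∣≡∣j-i∣ y′ y))

pathShape : ∀ {n} → Path n → Shape
pathShape {n} P = record
  { size          = n
  ; pos           = node
  ; Edge          = PathEdge
  ; pos-injective = node-injective
  ; edge-sym      = swap
  ; edge-adjacent = λ { (inj₁ e) → next-adjacent e
                      ; (inj₂ e) → Adjacent-sym {node _} {node _} (next-adjacent e) }
  ; connected     = λ u v → reverse swap (fromFirst u) ◅◅ fromFirst v
  }
  where
  open Path P

  PathEdge : Rel (Fin n) 0ℓ
  PathEdge i j = Next i j ⊎ Next j i

  walk : ∀ i (p : 0 ℕ.< n) (i<n : i ℕ.< n) → Star PathEdge (fromℕ< p) (fromℕ< i<n)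
  walk ℕ.zero    p i<n = ε
  walk (ℕ.suc i) p i<n = walk i p i′<n ◅◅ inj₁ next ◅ ε
    where
    i′<n = ℕₚ.<-trans (ℕₚ.n<1+n i) i<n
    next : Next (fromℕ< i′<n) (fromℕ< i<n)
    next = trans (toℕ-fromℕ< i<n) (cong ℕ.suc (sym (toℕ-fromℕ< i′<n)))

  0<n : Fin n → 0 ℕ.< n
  0<n v = ℕₚ.≤-<-trans ℕ.z≤n (toℕ<n v)

  fromFirst : ∀ v → Star PathEdge (fromℕ< (0<n v)) v
  fromFirst v = subst (Star PathEdge _) (fromℕ<-toℕ v (toℕ<n v)) (walk (toℕ v) (0<n v) (toℕ<n v))

data Sense : Set where
  clockwise counterclockwise : Sense

rotate : Sense → Point → Point
rotate clockwise        (x , y) = y , - x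
rotate counterclockwise (x , y) = - y , x

-- Nodes are listed from the internal to the external endpoint.
record Spiral (n : ℕ) : Set where
  field
    path : Path n
  open Path path public
  field
    sense      : Sense
    one-sense  : ∀ {h i j} → Bend h i j → node j ⊖ node i ≡ rotate sense (node i ⊖ node h)
    -- A segment turns only once it has got, in its own direction, strictly
    -- beyond everything before it.  The last segment ends without turning, so
    -- its length is arbitrary.
    outward    : ∀ {h i j} → Bend h i j → ∀ {g} → toℕ g ℕ.< toℕ i →
                 dot (node g) (node i ⊖ node h) < dot (node i) (node i ⊖ node h)

externalEndpoint : ∀ {m} → Spiral (ℕ.suc m) → Fin (ℕ.suc m)
externalEndpoint {m} _ = fromℕ m

anchoredAtExternal : ∀ {m} → Spiral (ℕ.suc m) → AnchoredShape
anchoredAtExternal P = record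
  { shape  = pathShape (Spiral.path P)
  ; anchor = externalEndpoint P
  }

{-# OPTIONS --safe #-}

-- A spiral is determined by the lengths ℓ₁, …, ℓ_r of its runs, from the
-- internal to the external endpoint, and it does not meet itself as soon as
-- ℓ_i > ℓ_{i-2} for all i < r.  Call g_i = ℓ_i - ℓ_{i-2} the gaps (g_r = ℓ_r).
-- The spiral whose gaps are all 1 grows by one run per time step: prolong the
-- internal endpoint and lengthen all runs on the same axis by 1.  From there,
-- if all gaps at most double then so do all lengths, so that two time steps,
-- one per axis, take the gaps ⌈g_i/2⌉ to the gaps g_i.  With T such rounds,
-- 2^T ≥ n, this makes r + 2T = O(log n) time steps.
--
-- No nodes collide: if u precedes v, then v lies beyond u in a direction which
-- depends only on the runs of u and v.  It is therefore the same before and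
-- after a time step, and by convexity v stays beyond u during the motion.

module Submission where

open import Data.Fin using (Fin; zero; suc; toℕ; fromℕ; inject₁)
import Data.Fin as Fin
import Data.Fin.Properties as Fin
open import Data.Fin.Subset using (Subset; Side; inside; outside; _∈_)
open import Data.Integer using (ℤ; +_; -[1+_]; -_; 0ℤ; 1ℤ; ∣_∣)
import Data.Integer as ℤ
import Data.Integer.Properties as ℤ
import Data.Integer.Tactic.RingSolver as ℤ-Solver
open import Data.List using (List; []; _∷_; length; filter; replicate)
import Data.List as List
open import Data.List.Properties using (filter-accept)
open import Data.List.Relation.Unary.All using (All; []; _∷_)
import Data.List.Relation.Unary.All as All
open import Data.Nat using (ℕ; zero; suc; _+_; _*_; _^_; _∸_; _≤_; _<_; z≤n; s≤s; s<s; ⌈_/2⌉; NonZero)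
import Data.Nat as ℕ
import Data.Nat.Properties as ℕ
open import Data.Nat.Logarithm using (⌊log₂_⌋; ⌊log₂⌋-mono-≤; ⌊log₂[2^n]⌋≡n)
import Data.Nat.Tactic.RingSolver as ℕ-Solver
open import Data.Product using (∃; ∃₂; _×_; _,_; proj₁; proj₂)
open import Data.Sum using (_⊎_; inj₁; inj₂; swap)
import Data.Sum as Sum
open import Data.Unit using (⊤; tt)
open import Data.Vec using (Vec; []; _∷_; lookup)
import Data.Vec as Vec
open import Data.Vec.Properties using ([]=⇒lookup; lookup⇒[]=; lookup∘tabulate)
open import Data.Vec.Properties.WithK using ([]=-irrelevant)
open import Function using (_∘_; id)
open import Function.Bundles using (_⇔_; mk↔ₛ′; mk⇔; Equivalence)
open import Function.Definitions using (Injective)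
open import Level using (0ℓ)
open import Relation.Binary.Core using (Rel)
open import Relation.Binary.Construct.Closure.ReflexiveTransitive using (Star; ε; _◅_)
open import Relation.Binary.Definitions using (Symmetric; tri<; tri≈; tri>)
open import Relation.Binary.PropositionalEquality
open import Relation.Nullary using (¬_; Dec; yes; no; contradiction)
open import Relation.Unary using (Decidable)
open import Defs

-- Points and directions

-- Halving the lengths themselves fails: 3 and 4 both become 2, and the strict inequality between
-- runs two apart is lost. Gaps rounded up stay positive, and positive gaps are all that a valid
-- spiral requires. Iterated halving ends at 1, which is why the doubling rounds start from the
-- spiral whose gaps are all 1. In the other direction, a length is the sum of the gaps on its axis
-- so far (the last run is its own gap), and a sum of terms that at most double at most doubles.
-- Doubling is the limit of one time step: an operation turns one letter into two equal ones, and in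
-- a step of direction `d` a letter can be operated on from only one of its ends. All operations of
-- a step share a direction, but both orientations of one axis can grow: a letter `d` from its inner
-- end and a letter `opp d` from its outer end. Hence one step per axis. The bound on the number of
-- turning points pays for the first phase, the bound n on the run lengths for the second.

⊕-assoc : ∀ p q r → p ⊕ q ⊕ r ≡ p ⊕ (q ⊕ r)
⊕-assoc (a , b) (c , d) (e , f) = cong₂ _,_ (ℤ.+-assoc a c e) (ℤ.+-assoc b d f)

⊕-identityʳ : ∀ p → p ⊕ origin ≡ p
⊕-identityʳ (a , b) = cong₂ _,_ (ℤ.+-identityʳ a) (ℤ.+-identityʳ b)

⊕-⊖-cancel : ∀ p q → p ⊕ (q ⊖ p) ≡ q
⊕-⊖-cancel (a , b) (c , d) = cong₂ _,_ (lemma a c) (lemma b d)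
  where
  lemma : ∀ a c → a ℤ.+ (c ℤ.- a) ≡ c
  lemma = ℤ-Solver.solve-∀

⊖-⊕-cancel : ∀ p q → p ⊖ q ⊕ q ≡ p
⊖-⊕-cancel (a , b) (c , d) = cong₂ _,_ (lemma a c) (lemma b d)
  where
  lemma : ∀ a c → a ℤ.- c ℤ.+ c ≡ a
  lemma = ℤ-Solver.solve-∀

p⊕q⊖p≡q : ∀ p q → p ⊕ q ⊖ p ≡ q
p⊕q⊖p≡q (a , b) (c , d) = cong₂ _,_ (lemma a c) (lemma b d)
  where
  lemma : ∀ a c → a ℤ.+ c ℤ.- a ≡ c
  lemma = ℤ-Solver.solve-∀

p⊖[p⊕q] : ∀ p q → p ⊖ (p ⊕ q) ≡ origin ⊖ q
p⊖[p⊕q] (a , b) (c , d) = cong₂ _,_ (lemma a c) (lemma b d)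
  where
  lemma : ∀ a c → a ℤ.- (a ℤ.+ c) ≡ 0ℤ ℤ.- c
  lemma = ℤ-Solver.solve-∀

⊕-cancelˡ : ∀ p {q r} → p ⊕ q ≡ p ⊕ r → q ≡ r
⊕-cancelˡ p {q} {r} eq = trans (sym (p⊕q⊖p≡q p q)) (trans (cong (_⊖ p) eq) (p⊕q⊖p≡q p r))

move-⊕ : ∀ {r} p q → r ≡ p ⊕ q → p ≡ r ⊕ (origin ⊖ q)
move-⊕ (a , b) (c , d) refl = sym (cong₂ _,_ (lemma a c) (lemma b d))
  where
  lemma : ∀ a c → a ℤ.+ c ℤ.+ (0ℤ ℤ.- c) ≡ a
  lemma = ℤ-Solver.solve-∀

dot-⊕ : ∀ p q e → dot (p ⊕ q) e ≡ dot p e ℤ.+ dot q e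
dot-⊕ (a , b) (c , d) (x , y) = lemma a b c d x y
  where
  lemma : ∀ a b c d x y → (a ℤ.+ c) ℤ.* x ℤ.+ (b ℤ.+ d) ℤ.* y
                        ≡ (a ℤ.* x ℤ.+ b ℤ.* y) ℤ.+ (c ℤ.* x ℤ.+ d ℤ.* y)
  lemma = ℤ-Solver.solve-∀

dot-⊖ : ∀ p q e → dot (p ⊖ q) e ≡ dot p e ℤ.- dot q e
dot-⊖ (a , b) (c , d) (x , y) = lemma a b c d x y
  where
  lemma : ∀ a b c d x y → (a ℤ.- c) ℤ.* x ℤ.+ (b ℤ.- d) ℤ.* y
                        ≡ (a ℤ.* x ℤ.+ b ℤ.* y) ℤ.- (c ℤ.* x ℤ.+ d ℤ.* y)
  lemma = ℤ-Solver.solve-∀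

dot-· : ∀ k p e → dot (k · p) e ≡ k ℤ.* dot p e
dot-· k (a , b) (x , y) = lemma k a b x y
  where
  lemma : ∀ k a b x y → k ℤ.* a ℤ.* x ℤ.+ k ℤ.* b ℤ.* y ≡ k ℤ.* (a ℤ.* x ℤ.+ b ℤ.* y)
  lemma = ℤ-Solver.solve-∀

dot-negʳ : ∀ p q → dot p (origin ⊖ q) ≡ - dot p q
dot-negʳ (a , b) (x , y) = lemma a b x y
  where
  lemma : ∀ a b x y → a ℤ.* (0ℤ ℤ.- x) ℤ.+ b ℤ.* (0ℤ ℤ.- y) ≡ - (a ℤ.* x ℤ.+ b ℤ.* y)
  lemma = ℤ-Solver.solve-∀

opp : Direction → Direction
opp north = south
opp east  = west
opp south = north
opp west  = east

opp-involutive : ∀ x → opp (opp x) ≡ x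
opp-involutive north = refl
opp-involutive east  = refl
opp-involutive south = refl
opp-involutive west  = refl

unit-opp : ∀ x → unit (opp x) ≡ origin ⊖ unit x
unit-opp north = refl
unit-opp east  = refl
unit-opp south = refl
unit-opp west  = refl

x≢opp-x : ∀ x → x ≢ opp x
x≢opp-x north ()
x≢opp-x east  ()
x≢opp-x south ()
x≢opp-x west  ()

_≟ᴰ_ : (x y : Direction) → Dec (x ≡ y)
north ≟ᴰ north = yes refl
north ≟ᴰ east  = no λ ()
north ≟ᴰ south = no λ ()
north ≟ᴰ west  = no λ ()
east  ≟ᴰ north = no λ ()
east  ≟ᴰ east  = yes refl
east  ≟ᴰ south = no λ ()
east  ≟ᴰ west  = no λ ()
south ≟ᴰ north = no λ ()
south ≟ᴰ east  = no λ ()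
south ≟ᴰ south = yes refl
south ≟ᴰ west  = no λ ()
west  ≟ᴰ north = no λ ()
west  ≟ᴰ east  = no λ ()
west  ≟ᴰ south = no λ ()
west  ≟ᴰ west  = yes refl

unit-injective : ∀ {x y} → unit x ≡ unit y → x ≡ y
unit-injective {north} {north} _ = refl
unit-injective {east}  {east}  _ = refl
unit-injective {south} {south} _ = refl
unit-injective {west}  {west}  _ = refl

dot-unit-self : ∀ x → dot (unit x) (unit x) ≡ 1ℤ
dot-unit-self north = refl
dot-unit-self east  = refl
dot-unit-self south = refl
dot-unit-self west  = refl

rot : Sense → Direction → Direction
rot clockwise        north = east
rot clockwise        east  = south
rot clockwise        south = west
rot clockwise        west  = north
rot counterclockwise north = west
rot counterclockwise east  = north
rot counterclockwise south = east
rot counterclockwise west  = south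

unit-rot : ∀ s x → unit (rot s x) ≡ rotate s (unit x)
unit-rot clockwise        north = refl
unit-rot clockwise        east  = refl
unit-rot clockwise        south = refl
unit-rot clockwise        west  = refl
unit-rot counterclockwise north = refl
unit-rot counterclockwise east  = refl
unit-rot counterclockwise south = refl
unit-rot counterclockwise west  = refl

rot-rot : ∀ s x → rot s (rot s x) ≡ opp x
rot-rot clockwise        north = refl
rot-rot clockwise        east  = refl
rot-rot clockwise        south = refl
rot-rot clockwise        west  = refl
rot-rot counterclockwise north = refl
rot-rot counterclockwise east  = refl
rot-rot counterclockwise south = refl
rot-rot counterclockwise west  = refl

x≢rot-x : ∀ s x → x ≢ rot s x
x≢rot-x clockwise        north ()
x≢rot-x clockwise        east  ()
x≢rot-x clockwise        south ()
x≢rot-x clockwise        west  ()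
x≢rot-x counterclockwise north ()
x≢rot-x counterclockwise east  ()
x≢rot-x counterclockwise south ()
x≢rot-x counterclockwise west  ()

dot-rotʳ : ∀ s x → dot (unit x) (unit (rot s x)) ≡ 0ℤ
dot-rotʳ clockwise        north = refl
dot-rotʳ clockwise        east  = refl
dot-rotʳ clockwise        south = refl
dot-rotʳ clockwise        west  = refl
dot-rotʳ counterclockwise north = refl
dot-rotʳ counterclockwise east  = refl
dot-rotʳ counterclockwise south = refl
dot-rotʳ counterclockwise west  = refl

dot-rotˡ : ∀ s x → dot (unit (rot s x)) (unit x) ≡ 0ℤ
dot-rotˡ clockwise        north = refl
dot-rotˡ clockwise        east  = refl
dot-rotˡ clockwise        south = refl
dot-rotˡ clockwise        west  = refl
dot-rotˡ counterclockwise north = refl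
dot-rotˡ counterclockwise east  = refl
dot-rotˡ counterclockwise south = refl
dot-rotˡ counterclockwise west  = refl

dot-unit-opp : ∀ p x → dot p (unit (opp x)) ≡ - dot p (unit x)
dot-unit-opp p x = trans (cong (dot p) (unit-opp x)) (dot-negʳ p (unit x))

-- Words and the separation of their nodes

-- The letters are the directions of the edges from the internal to the
-- external endpoint; the path is held at its external endpoint `p`.
Word : ℕ → Set
Word = Vec Direction

posW : Point → ∀ {m} → Word m → Fin (suc m) → Point
posW p []      zero    = p
posW p (x ∷ w) zero    = posW p w zero ⊖ unit x
posW p (x ∷ w) (suc i) = posW p w i

posW-last : ∀ p {m} (w : Word m) → posW p w (fromℕ m) ≡ p
posW-last p []      = refl
posW-last p (x ∷ w) = posW-last p w

posW-∷ : ∀ p {m} x (w : Word m) → posW p w zero ≡ posW p (x ∷ w) zero ⊕ unit x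
posW-∷ p x w = sym (⊖-⊕-cancel (posW p w zero) (unit x))

posW-step : ∀ p {m} (w : Word m) i →
            posW p w (suc i) ≡ posW p w (inject₁ i) ⊕ unit (lookup w i)
posW-step p (x ∷ w) zero    = posW-∷ p x w
posW-step p (x ∷ w) (suc i) = posW-step p w i

-- The run before the one that ends in node `i` brings the path strictly beyond
-- all earlier nodes, and the last run keeps this lead, so its direction
-- separates `i` from them; `cur` is the letter before `w`, and `sep` is the
-- direction that separates the first node of `w`.
separator : (cur sep : Direction) → ∀ {m} → Word m → Fin (suc m) → Direction
update    : (cur sep y : Direction) → Direction

update cur sep y with y ≟ᴰ cur
... | yes _ = sep
... | no  _ = cur

separator cur sep w       zero    = sep
separator cur sep (y ∷ w) (suc i) = separator y (update cur sep y) w i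

update-same : ∀ cur sep → update cur sep cur ≡ sep
update-same cur sep with cur ≟ᴰ cur
... | yes _ = refl
... | no cur≢cur = contradiction refl cur≢cur

update-other : ∀ {cur y} sep → cur ≢ y → update cur sep y ≡ cur
update-other {cur} {y} sep cur≢y with y ≟ᴰ cur
... | yes y≡cur = contradiction (sym y≡cur) cur≢y
... | no _      = refl

infix 4 _<[_]_

_<[_]_ : Point → Direction → Point → Set
b <[ e ] p = dot b (unit e) ℤ.< dot p (unit e)

<[]-irrefl : ∀ {p} e → ¬ (p <[ e ] p)
<[]-irrefl e = ℤ.<-irrefl refl

-- One condition for each suffix, as every node has to serve as the earlier one of a pair. Both
-- directions given to `separator` start as `x`, because the letter `x` alone already puts the first
-- node of `w` ahead.
data Separated (p : Point) : ∀ {m} → Word m → Set where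
  []  : Separated p []
  _∷_ : ∀ {m x} {w : Word m} →
        (∀ i → posW p (x ∷ w) zero <[ separator x x w i ] posW p w i) →
        Separated p w → Separated p (x ∷ w)

posW-injective : ∀ {p m} {w : Word m} → Separated p w → ∀ {i j} → posW p w i ≡ posW p w j → i ≡ j
posW-injective sep {zero} {zero} eq = refl
posW-injective {p} {w = x ∷ w} (sep ∷ _) {zero} {suc j} eq =
  contradiction (subst (λ q → q <[ separator x x w j ] posW p w j) eq (sep j))
                (<[]-irrefl {posW p w j} (separator x x w j))
posW-injective {p} {w = x ∷ w} (sep ∷ _) {suc i} {zero} eq =
  contradiction (subst (λ q → q <[ separator x x w i ] posW p w i) (sym eq) (sep i))
                (<[]-irrefl {posW p w i} (separator x x w i))
posW-injective (_ ∷ seps) {suc i} {suc j} eq = cong suc (posW-injective seps eq)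

-- Expansions of words

-- Which neighbouring place on the path the node created by the operation on a
-- node takes; `left` is towards the internal endpoint.
data Mark : Set where
  none left right : Mark

side : Mark → Side
side none  = outside
side left  = inside
side right = inside

-- A time step in direction `d` turns `w` into `w′`.  The index is the mark of
-- the first node.  A created node lies in direction `d`, so an operation
-- marked `right` doubles a letter `d` and one marked `left` a letter `opp d`;
-- `left` at the internal endpoint prolongs the path instead.
data Expansion (d : Direction) : ∀ {m m′} → Mark → Word m → Word m′ → Set where
  end   : Expansion d none [] []
  keep  : ∀ {m m′ a x} {w : Word m} {w′ : Word m′} → (a ≡ left → x ≡ opp d) →
          Expansion d a w w′ → Expansion d none (x ∷ w) (x ∷ w′)
  right : ∀ {m m′ a} {w : Word m} {w′ : Word m′} → a ≢ left →
          Expansion d a w w′ → Expansion d right (d ∷ w) (d ∷ d ∷ w′)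
  left  : ∀ {m m′} {w : Word m} {w′ : Word m′} →
          Expansion d none w w′ → Expansion d left w (opp d ∷ w′)

module _ {d : Direction} where

  private variable
    m m′ : ℕ
    a    : Mark

  mark : ∀ {w : Word m} {w′ : Word m′} → Expansion d a w w′ → Fin (suc m) → Mark
  mark end         zero    = none
  mark (keep _ e)  zero    = none
  mark (keep _ e)  (suc i) = mark e i
  mark (right _ e) zero    = right
  mark (right _ e) (suc i) = mark e i
  mark (left e)    zero    = left
  mark (left e)    (suc i) = mark e (suc i)

  old : ∀ {w : Word m} {w′ : Word m′} → Expansion d a w w′ → Fin (suc m) → Fin (suc m′)
  old end         zero    = zero
  old (keep _ e)  zero    = zero
  old (keep _ e)  (suc i) = suc (old e i)
  old (right _ e) zero    = zero
  old (right _ e) (suc i) = suc (suc (old e i))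
  old (left e)    i       = suc (old e i)

  -- A junk value if `i` is unmarked.
  new : ∀ {w : Word m} {w′ : Word m′} → Expansion d a w w′ → Fin (suc m) → Fin (suc m′)
  new end         zero    = zero
  new (keep _ e)  zero    = zero
  new (keep _ e)  (suc i) = suc (new e i)
  new (right _ e) zero    = suc zero
  new (right _ e) (suc i) = suc (suc (new e i))
  new (left e)    zero    = zero
  new (left e)    (suc i) = suc (new e (suc i))

  -- `inj₁ i` stands for the old node `i` and `inj₂ i` for the one created from it.
  origins : ∀ {w : Word m} {w′ : Word m′} → Expansion d a w w′ →
            Fin (suc m′) → Fin (suc m) ⊎ Fin (suc m)
  origins end         zero          = inj₁ zero
  origins (keep _ e)  zero          = inj₁ zero
  origins (keep _ e)  (suc k)       = Sum.map suc suc (origins e k)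
  origins (right _ e) zero          = inj₁ zero
  origins (right _ e) (suc zero)    = inj₂ zero
  origins (right _ e) (suc (suc k)) = Sum.map suc suc (origins e k)
  origins (left e)    zero          = inj₂ zero
  origins (left e)    (suc k)       = origins e k

  Marked : ∀ {w : Word m} {w′ : Word m′} → Expansion d a w w′ → Fin (suc m) → Set
  Marked e i = side (mark e i) ≡ inside

  mark-zero : ∀ {w : Word m} {w′ : Word m′} (e : Expansion d a w w′) → mark e zero ≡ a
  mark-zero end         = refl
  mark-zero (keep _ _)  = refl
  mark-zero (right _ _) = refl
  mark-zero (left _)    = refl

  old-zero : ∀ {w : Word m} {w′ : Word m′} (e : Expansion d a w w′) → a ≢ left → old e zero ≡ zero
  old-zero end         _ = refl
  old-zero (keep _ _)  _ = refl
  old-zero (right _ _) _ = refl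
  old-zero (left _)    a≢left = contradiction refl a≢left

  origins-zero : ∀ {w : Word m} {w′ : Word m′} (e : Expansion d a w w′) → a ≢ left → origins e zero ≡ inj₁ zero
  origins-zero end         _ = refl
  origins-zero (keep _ _)  _ = refl
  origins-zero (right _ _) _ = refl
  origins-zero (left _)    a≢left = contradiction refl a≢left

  old-last : ∀ {w : Word m} {w′ : Word m′} (e : Expansion d a w w′) → old e (fromℕ m) ≡ fromℕ m′
  old-last end         = refl
  old-last (keep _ e)  = cong suc (old-last e)
  old-last (right _ e) = cong (λ k → suc (suc k)) (old-last e)
  old-last (left e)    = cong suc (old-last e)

  origins-old : ∀ {w : Word m} {w′ : Word m′} (e : Expansion d a w w′) i → origins e (old e i) ≡ inj₁ i
  origins-old end         zero    = refl
  origins-old (keep _ e)  zero    = refl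
  origins-old (keep _ e)  (suc i) = cong (Sum.map suc suc) (origins-old e i)
  origins-old (right _ e) zero    = refl
  origins-old (right _ e) (suc i) = cong (Sum.map suc suc) (origins-old e i)
  origins-old (left e)    i       = origins-old e i

  origins-new : ∀ {w : Word m} {w′ : Word m′} (e : Expansion d a w w′) i → Marked e i → origins e (new e i) ≡ inj₂ i
  origins-new end         zero    ()
  origins-new (keep _ e)  zero    ()
  origins-new (keep _ e)  (suc i) q = cong (Sum.map suc suc) (origins-new e i q)
  origins-new (right _ e) zero    q = refl
  origins-new (right _ e) (suc i) q = cong (Sum.map suc suc) (origins-new e i q)
  origins-new (left e)    zero    q = refl
  origins-new (left e)    (suc i) q = origins-new e (suc i) q

  OriginOf : ∀ {w : Word m} {w′ : Word m′} → Expansion d a w w′ →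
             Fin (suc m′) → Fin (suc m) ⊎ Fin (suc m) → Set
  OriginOf e k (inj₁ i) = old e i ≡ k
  OriginOf e k (inj₂ i) = Marked e i × new e i ≡ k

  origins-sound : ∀ {w : Word m} {w′ : Word m′} (e : Expansion d a w w′) k → OriginOf e k (origins e k)
  origins-sound end         zero          = refl
  origins-sound (keep _ e)  zero          = refl
  origins-sound (keep _ e)  (suc k) with origins e k | origins-sound e k
  ... | inj₁ i | eq     = cong suc eq
  ... | inj₂ i | q , eq = q , cong suc eq
  origins-sound (right _ e) zero          = refl
  origins-sound (right _ e) (suc zero)    = refl , refl
  origins-sound (right _ e) (suc (suc k)) with origins e k | origins-sound e k
  ... | inj₁ i | eq     = cong (λ j → suc (suc j)) eq
  ... | inj₂ i | q , eq = q , cong (λ j → suc (suc j)) eq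
  origins-sound (left e)    zero          = refl , refl
  origins-sound (left e)    (suc k) with origins e k | origins-sound e k
  ... | inj₁ i       | eq     = cong suc eq
  ... | inj₂ zero    | q , eq = contradiction (trans (sym (cong side (mark-zero e))) q) λ ()
  ... | inj₂ (suc i) | q , eq = q , cong suc eq

  old≢new : ∀ {w : Word m} {w′ : Word m′} (e : Expansion d a w w′) i j → Marked e j → old e i ≢ new e j
  old≢new e i j q eq with trans (sym (origins-old e i)) (trans (cong (origins e) eq) (origins-new e j q))
  ... | ()

  -- The possible pairs of neighbours on the expanded path, in terms of origins. It serves the
  -- converse half of `preserves-edge`, where an edge of the result has to be traced back to a
  -- `NewEdge`; `next-old-old` and its companions serve the other half.
  data Consecutive {w : Word m} {w′ : Word m′} (e : Expansion d a w w′) :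
                   Fin (suc m) ⊎ Fin (suc m) → Fin (suc m) ⊎ Fin (suc m) → Set where
    old-old  : ∀ i → mark e (inject₁ i) ≢ right → mark e (suc i) ≢ left →
               Consecutive e (inj₁ (inject₁ i)) (inj₁ (suc i))
    to-right : ∀ i → mark e i ≡ right → Consecutive e (inj₁ i) (inj₂ i)
    to-left  : ∀ i → mark e i ≡ left → Consecutive e (inj₂ i) (inj₁ i)
    new-old  : ∀ i → mark e (inject₁ i) ≡ right → Consecutive e (inj₂ (inject₁ i)) (inj₁ (suc i))
    old-new  : ∀ i → mark e (suc i) ≡ left → Consecutive e (inj₁ (inject₁ i)) (inj₂ (suc i))

  private
    keep⁺ : ∀ {x} {w : Word m} {w′ : Word m′} {e : Expansion d a w w′} (o : a ≡ left → x ≡ opp d) {k l} →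
            Consecutive e k l → Consecutive (keep o e) (Sum.map suc suc k) (Sum.map suc suc l)
    keep⁺ o (old-old i r l) = old-old (suc i) r l
    keep⁺ o (to-right i r)  = to-right (suc i) r
    keep⁺ o (to-left i l)   = to-left (suc i) l
    keep⁺ o (new-old i r)   = new-old (suc i) r
    keep⁺ o (old-new i l)   = old-new (suc i) l

    right⁺ : ∀ {w : Word m} {w′ : Word m′} {e : Expansion d a w w′} (o : a ≢ left) {k l} →
             Consecutive e k l → Consecutive (right o e) (Sum.map suc suc k) (Sum.map suc suc l)
    right⁺ o (old-old i r l) = old-old (suc i) r l
    right⁺ o (to-right i r)  = to-right (suc i) r
    right⁺ o (to-left i l)   = to-left (suc i) l
    right⁺ o (new-old i r)   = new-old (suc i) r
    right⁺ o (old-new i l)   = old-new (suc i) l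

    unmarked-zero : ∀ {w : Word m} {w′ : Word m′} (e : Expansion d none w w′) {a} → mark e zero ≡ a → none ≡ a
    unmarked-zero e eq = trans (sym (mark-zero e)) eq

    -- Unlike in `keep⁺` and `right⁺` the origins are not shifted, since `left` adds a node to the
    -- result only. The mark of the first node changes from `none` to `left`, so the cases in which
    -- it already carried a mark are void.
    left⁺ : ∀ {w : Word m} {w′ : Word m′} {e : Expansion d none w w′} {k l} →
            Consecutive e k l → Consecutive (left e) k l
    left⁺ (old-old zero r l)    = old-old zero (λ ()) l
    left⁺ (old-old (suc i) r l) = old-old (suc i) r l
    left⁺ {e = e} (to-right zero r) = contradiction (unmarked-zero e r) λ ()
    left⁺ (to-right (suc i) r)  = to-right (suc i) r
    left⁺ {e = e} (to-left zero l)  = contradiction (unmarked-zero e l) λ ()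
    left⁺ (to-left (suc i) l)   = to-left (suc i) l
    left⁺ {e = e} (new-old zero r)  = contradiction (unmarked-zero e r) λ ()
    left⁺ (new-old (suc i) r)   = new-old (suc i) r
    left⁺ (old-new i l)         = old-new i l

  none≢left : none ≢ left
  none≢left ()

  consecutive : ∀ {w : Word m} {w′ : Word m′} (e : Expansion d a w w′) k →
                Consecutive e (origins e (inject₁ k)) (origins e (suc k))
  consecutive (keep o end)           zero = old-old zero (λ ()) λ ()
  consecutive (keep o (keep _ _))    zero = old-old zero (λ ()) λ ()
  consecutive (keep o (right _ _))   zero = old-old zero (λ ()) λ ()
  consecutive (keep o (left _))      zero = old-new zero refl
  consecutive (keep o e)             (suc k) = keep⁺ o (consecutive e k)
  consecutive (right o e)            zero = to-right zero refl
  consecutive (right o e)            (suc zero) rewrite origins-zero e o = new-old zero refl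
  consecutive (right o e)            (suc (suc k)) = right⁺ o (consecutive e k)
  consecutive (left e)               zero rewrite origins-zero e none≢left = to-left zero refl
  consecutive (left e)               (suc k) = left⁺ (consecutive e k)

  next-old-old : ∀ {w : Word m} {w′ : Word m′} (e : Expansion d a w w′) i →
                 mark e (inject₁ i) ≢ right → mark e (suc i) ≢ left → Next (old e (inject₁ i)) (old e (suc i))
  next-old-old (keep {a = a} o e) zero r l =
    cong (λ k → suc (toℕ k)) (old-zero e λ a≡left → l (trans (mark-zero e) a≡left))
  next-old-old (keep o e)  (suc i) r l = cong suc (next-old-old e i r l)
  next-old-old (right o e) zero    r l = contradiction refl r
  next-old-old (right o e) (suc i) r l = cong (λ k → suc (suc k)) (next-old-old e i r l)
  next-old-old (left e)    zero    r l = cong suc (next-old-old e zero (λ r′ → contradiction (unmarked-zero e r′) λ ()) l)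
  next-old-old (left e)    (suc i) r l = cong suc (next-old-old e (suc i) r l)

  next-to-right : ∀ {w : Word m} {w′ : Word m′} (e : Expansion d a w w′) i →
                  mark e i ≡ right → Next (old e i) (new e i)
  next-to-right end         zero    ()
  next-to-right (keep o e)  zero    ()
  next-to-right (keep o e)  (suc i) r = cong suc (next-to-right e i r)
  next-to-right (right o e) zero    r = refl
  next-to-right (right o e) (suc i) r = cong (λ k → suc (suc k)) (next-to-right e i r)
  next-to-right (left e)    zero    ()
  next-to-right (left e)    (suc i) r = cong suc (next-to-right e (suc i) r)

  next-to-left : ∀ {w : Word m} {w′ : Word m′} (e : Expansion d a w w′) i →
                 mark e i ≡ left → Next (new e i) (old e i)
  next-to-left end         zero    ()
  next-to-left (keep o e)  zero    ()
  next-to-left (keep o e)  (suc i) l = cong suc (next-to-left e i l)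
  next-to-left (right o e) zero    ()
  next-to-left (right o e) (suc i) l = cong (λ k → suc (suc k)) (next-to-left e i l)
  next-to-left (left e)    zero    l = cong (λ k → suc (toℕ k)) (old-zero e none≢left)
  next-to-left (left e)    (suc i) l = cong suc (next-to-left e (suc i) l)

  next-new-old : ∀ {w : Word m} {w′ : Word m′} (e : Expansion d a w w′) i →
                 mark e (inject₁ i) ≡ right → Next (new e (inject₁ i)) (old e (suc i))
  next-new-old (keep o e)  zero    ()
  next-new-old (keep o e)  (suc i) r = cong suc (next-new-old e i r)
  next-new-old (right o e) zero    r = cong (λ k → suc (suc (toℕ k))) (old-zero e o)
  next-new-old (right o e) (suc i) r = cong (λ k → suc (suc k)) (next-new-old e i r)
  next-new-old (left e)    zero    ()
  next-new-old (left e)    (suc i) r = cong suc (next-new-old e (suc i) r)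

  next-old-new : ∀ {w : Word m} {w′ : Word m′} (e : Expansion d a w w′) i →
                 mark e (suc i) ≡ left → Next (old e (inject₁ i)) (new e (suc i))
  next-old-new (keep o (left e)) zero l = refl
  next-old-new (keep o (keep _ _)) zero ()
  next-old-new (keep o (right _ _)) zero ()
  next-old-new (keep o end) zero ()
  next-old-new (keep o e)  (suc i) l = cong suc (next-old-new e i l)
  next-old-new (right o e) zero    l = contradiction (trans (sym (mark-zero e)) l) o
  next-old-new (right o e) (suc i) l = cong (λ k → suc (suc k)) (next-old-new e i l)
  next-old-new (left e)    zero    l = cong suc (next-old-new e zero l)
  next-old-new (left e)    (suc i) l = cong suc (next-old-new e (suc i) l)

  posW-new : ∀ p {w : Word m} {w′ : Word m′} (e : Expansion d a w w′) i → Marked e i →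
             posW p w′ (new e i) ≡ posW p w′ (old e i) ⊕ unit d
  posW-new p end         zero    ()
  posW-new p (keep o e)  zero    ()
  posW-new p (keep o e)  (suc i) q = posW-new p e i q
  posW-new p (right {w′ = w′} o e) zero q = posW-∷ p d (d ∷ w′)
  posW-new p (right o e) (suc i) q = posW-new p e i q
  posW-new p (left {w′ = w′} e) zero q rewrite old-zero e none≢left | unit-opp d = lemma (posW p w′ zero) (unit d)
    where
    coord : ∀ a b → a ℤ.- (0ℤ ℤ.- b) ≡ a ℤ.+ b
    coord = ℤ-Solver.solve-∀
    lemma : ∀ p q → p ⊖ (origin ⊖ q) ≡ p ⊕ q
    lemma (a , b) (x , y) = cong₂ _,_ (coord a x) (coord b y)
  posW-new p (left e)    (suc i) q = posW-new p e (suc i) q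

  right-letter : ∀ {w : Word m} {w′ : Word m′} (e : Expansion d a w w′) i →
                 mark e (inject₁ i) ≡ right → lookup w i ≡ d
  right-letter (keep _ e)  (suc i) r = right-letter e i r
  right-letter (right _ e) zero    r = refl
  right-letter (right _ e) (suc i) r = right-letter e i r
  right-letter (left e)    (suc i) r = right-letter e (suc i) r

  left-letter : ∀ {w : Word m} {w′ : Word m′} (e : Expansion d a w w′) i →
                mark e (suc i) ≡ left → lookup w i ≡ opp d
  left-letter (keep o e)  zero    l = o (trans (sym (mark-zero e)) l)
  left-letter (keep o e)  (suc i) l = left-letter e i l
  left-letter (right o e) zero    l = contradiction (trans (sym (mark-zero e)) l) o
  left-letter (right _ e) (suc i) l = left-letter e i l
  left-letter (left e)    zero    l = left-letter e zero l
  left-letter (left e)    (suc i) l = left-letter e (suc i) l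

  -- An old edge keeps its length or becomes two letters long. The marks are recorded along with the
  -- positions: `Split` and the new edges are recovered from the marks, displacements from the
  -- positions.
  data Stretch (p : Point) {w : Word m} {w′ : Word m′} (e : Expansion d a w w′) (i : Fin m) : Set where
    rigid    : mark e (inject₁ i) ≢ right → mark e (suc i) ≢ left →
               posW p w′ (old e (suc i)) ≡ posW p w′ (old e (inject₁ i)) ⊕ unit (lookup w i) →
               Stretch p e i
    at-right : mark e (inject₁ i) ≡ right →
               posW p w′ (old e (suc i)) ≡ posW p w′ (old e (inject₁ i)) ⊕ unit (lookup w i) ⊕ unit (lookup w i) →
               Stretch p e i
    at-left  : mark e (suc i) ≡ left →
               posW p w′ (old e (suc i)) ≡ posW p w′ (old e (inject₁ i)) ⊕ unit (lookup w i) ⊕ unit (lookup w i) →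
               Stretch p e i

  stretch-first : ∀ p {x} {w : Word m} {w′ : Word m′} (o : a ≡ left → x ≡ opp d)
                  (e : Expansion d a w w′) →
                  a ≢ left → Stretch p (keep o e) zero
  stretch-first p {x = x} {w′ = w′} o e a≢left =
    rigid (λ ()) (λ l → a≢left (trans (sym (mark-zero e)) l))
          (trans (cong (posW p w′) (old-zero e a≢left)) (posW-∷ p x w′))

  stretch : ∀ p {w : Word m} {w′ : Word m′} (e : Expansion d a w w′) i → Stretch p e i
  stretch p (keep o e@end)         zero = stretch-first p o e λ ()
  stretch p (keep o e@(keep _ _))  zero = stretch-first p o e λ ()
  stretch p (keep o e@(right _ _)) zero = stretch-first p o e λ ()
  stretch p (keep o (left {w′ = w′} e)) zero with refl ← o refl =
    at-left refl
      (trans (cong (posW p w′) (old-zero e none≢left))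
      (trans (posW-∷ p (opp d) w′) (cong (_⊕ unit (opp d)) (posW-∷ p (opp d) (opp d ∷ w′)))))
  stretch p (keep o e) (suc i) with stretch p e i
  ... | rigid r l eq     = rigid r l eq
  ... | at-right r eq  = at-right r eq
  ... | at-left l eq   = at-left l eq
  stretch p (right {w′ = w′} o e) zero =
    at-right refl
      (trans (cong (posW p w′) (old-zero e o))
      (trans (posW-∷ p d w′) (cong (_⊕ unit d) (posW-∷ p d (d ∷ w′)))))
  stretch p (right o e) (suc i) with stretch p e i
  ... | rigid r l eq     = rigid r l eq
  ... | at-right r eq  = at-right r eq
  ... | at-left l eq   = at-left l eq
  stretch p (left e) zero with stretch p e zero
  ... | rigid r l eq     = rigid (λ ()) l eq
  ... | at-right r eq  = contradiction (unmarked-zero e r) λ ()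
  ... | at-left l eq   = at-left l eq
  stretch p (left e) (suc i) with stretch p e (suc i)
  ... | rigid r l eq     = rigid r l eq
  ... | at-right r eq  = at-right r eq
  ... | at-left l eq   = at-left l eq

  -- An inserted letter repeats the letter before it, so `update` leaves the separating direction
  -- alone (`update-same`). For an insertion by `left` at the very front, the letter before it is
  -- `cur`, whence the condition that `cur` be `opp d`.
  separator-old : ∀ {w : Word m} {w′ : Word m′} (e : Expansion d a w w′) {cur} sep → (a ≡ left → cur ≡ opp d) → ∀ i →
                  separator cur sep w′ (old e i) ≡ separator cur sep w i
  separator-old end sep o zero = refl
  separator-old (keep o′ e) sep o zero = refl
  separator-old (keep o′ e) sep o (suc i) = separator-old e _ o′ i
  separator-old (right o′ e) sep o zero = refl
  separator-old (right o′ e) {cur} sep o (suc i) rewrite update-same d (update cur sep d) =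
    separator-old e _ (λ a≡left → contradiction a≡left o′) i
  separator-old (left e) sep o i with refl ← o refl rewrite update-same (opp d) sep =
    separator-old e sep (λ ()) i

  -- Each of the two `Separated` proofs supplies a direction, and `separator-old` makes them the
  -- same one. A single direction valid at both ends of the motion is what the convexity argument
  -- takes as input.
  common-separator : ∀ {p} {w : Word m} {w′ : Word m′} (e : Expansion d a w w′) →
                     Separated p w → Separated p w′ → ∀ {i j} → i Fin.< j →
                     ∃ λ f → posW p w i <[ f ] posW p w j × posW p w′ (old e i) <[ f ] posW p w′ (old e j)
  common-separator end [] [] {zero} {zero} ()
  common-separator {p = p} (keep {x = x} {w} {w′} o e) (s ∷ _) (s′ ∷ _) {zero} {suc j} _ =
    separator x x w j , s j ,
    subst (λ f → posW p (x ∷ w′) zero <[ f ] posW p w′ (old e j)) (separator-old e x o j) (s′ (old e j))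
  common-separator {p = p} (right {w = w} {w′} o e) (s ∷ _) (s′ ∷ _) {zero} {suc j} _ =
    separator d d w j , s j ,
    subst (λ f → posW p (d ∷ d ∷ w′) zero <[ f ] posW p w′ (old e j))
      (trans (cong (λ f → separator d f w′ (old e j)) (update-same d d))
             (separator-old e d (λ a≡left → contradiction a≡left o) j))
      (s′ (suc (old e j)))
  common-separator (keep o e) (_ ∷ ss) (_ ∷ ss′) {suc i} {suc j} (s<s i<j) = common-separator e ss ss′ i<j
  common-separator (right o e) (_ ∷ ss) (_ ∷ _ ∷ ss′) {suc i} {suc j} (s<s i<j) = common-separator e ss ss′ i<j
  common-separator (left e) ss (_ ∷ ss′) i<j = common-separator e ss ss′ i<j

-- The time step that realises an expansion

-- An anchored shape that is the path of `w`, whatever its proof components and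
-- the definition of its edges.
record Realisation (p : Point) {m} (w : Word m) : Set₁ where
  field
    pos           : Fin (suc m) → Point
    Edge          : Rel (Fin (suc m)) 0ℓ
    pos-injective : Injective _≡_ _≡_ pos
    edge-sym      : Symmetric Edge
    edge-adjacent : ∀ {u v} → Edge u v → Adjacent (pos u) (pos v)
    connected     : ∀ u v → Star Edge u v
    pos-posW      : ∀ i → pos i ≡ posW p w i
    edge⇔         : ∀ {i j} → Edge i j ⇔ (Next i j ⊎ Next j i)

  anchored : AnchoredShape
  anchored = record
    { shape = record
      { pos           = pos
      ; Edge          = Edge
      ; pos-injective = pos-injective
      ; edge-sym      = edge-sym
      ; edge-adjacent = edge-adjacent
      ; connected     = connected
      }
    ; anchor = fromℕ m
    }

singleNode-realisation : ∀ p → Realisation p []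
singleNode-realisation p = record
  { pos           = pos
  ; Edge          = Edge
  ; pos-injective = pos-injective
  ; edge-sym      = λ {u} {v} → edge-sym {u} {v}
  ; edge-adjacent = λ {u} {v} → edge-adjacent {u} {v}
  ; connected     = connected
  ; pos-posW      = λ { zero → refl }
  ; edge⇔         = λ { {zero} {zero} → mk⇔ (λ ()) λ { (inj₁ ()) ; (inj₂ ()) } }
  }
  where open AnchoredShape (singleNode p)

path-realisation : ∀ {p m} {w : Word m} (P : Path (suc m)) → (∀ i → Path.node P i ≡ posW p w i) →
                   Realisation p w
path-realisation P node≗ = record
  { pos           = pos
  ; Edge          = Edge
  ; pos-injective = pos-injective
  ; edge-sym      = λ {u} {v} → edge-sym {u} {v}
  ; edge-adjacent = λ {u} {v} → edge-adjacent {u} {v}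
  ; connected     = connected
  ; pos-posW      = node≗
  ; edge⇔         = mk⇔ (λ e → e) (λ e → e)
  }
  where open Shape (pathShape P)

next⇒step : ∀ {m} {i j : Fin (suc m)} → Next i j → ∃ λ k → i ≡ inject₁ k × j ≡ suc k
next⇒step {i = i} {suc k} eq = k , Fin.toℕ-injective (trans (sym (ℕ.suc-injective eq)) (sym (Fin.toℕ-inject₁ k))) , refl

step⇒next : ∀ {m} (k : Fin m) → Next (inject₁ k) (suc k)
step⇒next k = cong suc (sym (Fin.toℕ-inject₁ k))

adjacent-unit : ∀ p x → Adjacent p (p ⊕ unit x)
adjacent-unit p@(_ , _) x = trans (cong (λ { (a , b) → ∣ a ∣ ℕ.+ ∣ b ∣ }) (p⊖[p⊕q] p (unit x))) (norm x)
  where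
  norm : ∀ x → ∣ 0ℤ ℤ.- proj₁ (unit x) ∣ ℕ.+ ∣ 0ℤ ℤ.- proj₂ (unit x) ∣ ≡ 1
  norm north = refl
  norm east  = refl
  norm south = refl
  norm west  = refl

wordPath : ∀ {p m} {w : Word m} → Separated p w → Path (suc m)
wordPath {p} {w = w} sep = record
  { node           = posW p w
  ; node-injective = posW-injective sep
  ; next-adjacent  = λ next → adjacent (next⇒step next)
  }
  where
  adjacent : ∀ {i j} → ∃ (λ k → i ≡ inject₁ k × j ≡ suc k) → Adjacent (posW p w i) (posW p w j)
  adjacent (k , refl , refl) =
    subst (Adjacent (posW p w (inject₁ k))) (sym (posW-step p w k)) 
          (adjacent-unit (posW p w (inject₁ k)) (lookup w k))

module _ {p d m m′ a} {w : Word m} {w′ : Word m′} (e : Expansion d a w w′)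
         (sep : Separated p w) (sep′ : Separated p w′)
         (R : Realisation p w) (R′ : Realisation p w′) where
  private
    module R  = Realisation R
    module R′ = Realisation R′

    pos  = posW p w
    pos′ = posW p w′

    Q : Subset (suc m)
    Q = Vec.tabulate (λ i → side (mark e i))

    open Operations R.anchored d Q

    ∈⇒Marked : ∀ {u} → u ∈ Q → Marked e u
    ∈⇒Marked {u} q = trans (sym (lookup∘tabulate (λ i → side (mark e i)) u)) ([]=⇒lookup q)

    Marked⇒∈ : ∀ {u} → Marked e u → u ∈ Q
    Marked⇒∈ {u} q = lookup⇒[]= u Q (trans (lookup∘tabulate (λ i → side (mark e i)) u) q)

    -- Read off from the target instead of summed along paths; `walk-contributions` then shows that
    -- it is the required sum.
    δ : Fin (suc m) → Point
    δ u = pos′ (old e u) ⊖ R.pos u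

    to : Node → Fin (suc m′)
    to (inj₁ u)       = old e u
    to (inj₂ (u , _)) = new e u

    pack : ∀ {k} s → OriginOf e k s → Node
    pack (inj₁ i) _       = inj₁ i
    pack (inj₂ i) (q , _) = inj₂ (i , Marked⇒∈ q)

    to-pack : ∀ {k} s (o : OriginOf e k s) → to (pack s o) ≡ k
    to-pack (inj₁ i) eq       = eq
    to-pack (inj₂ i) (_ , eq) = eq

    pack-old : ∀ {k} s (o : OriginOf e k s) {i} → s ≡ inj₁ i → pack s o ≡ inj₁ i
    pack-old _ o refl = refl

    pack-new : ∀ {k} s (o : OriginOf e k s) {i} (q : i ∈ Q) → s ≡ inj₂ i → pack s o ≡ inj₂ (i , q)
    -- Membership proofs in `Q` are unique, so a created node is determined by the node operated on.
    pack-new _ o q refl = cong (λ q → inj₂ (_ , q)) ([]=-irrelevant _ q)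

    from : Fin (suc m′) → Node
    from k = pack (origins e k) (origins-sound e k)

    from-to : ∀ x → from (to x) ≡ x
    from-to (inj₁ u)       = pack-old _ _ (origins-old e u)
    from-to (inj₂ (u , q)) = pack-new _ _ q (origins-new e u (∈⇒Marked q))

    to-from : ∀ k → to (from k) ≡ k
    to-from k = to-pack (origins e k) (origins-sound e k)

    newPos-to : ∀ x → newPos δ x ≡ pos′ (to x)
    newPos-to (inj₁ u)       = ⊕-⊖-cancel (R.pos u) (pos′ (old e u))
    newPos-to (inj₂ (u , q)) =
      trans (cong (_⊕ unit d) (⊕-⊖-cancel (R.pos u) (pos′ (old e u)))) (sym (posW-new p e u (∈⇒Marked q)))

    R-step : ∀ i → R.pos (suc i) ≡ R.pos (inject₁ i) ⊕ unit (lookup w i)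
    R-step i = trans (R.pos-posW (suc i)) 
               (trans (posW-step p w i) (cong (_⊕ unit (lookup w i)) (sym (R.pos-posW (inject₁ i)))))

    letter : ∀ i y → R.pos (suc i) ≡ R.pos (inject₁ i) ⊕ unit y → lookup w i ≡ y
    letter i y eq = unit-injective (⊕-cancelˡ (R.pos (inject₁ i)) (trans (sym (R-step i)) eq))

    flip : ∀ q r x → r ≡ q ⊕ unit x → q ≡ r ⊕ unit (opp x)
    flip q r x eq = trans (move-⊕ q (unit x) eq) (cong (r ⊕_) (sym (unit-opp x)))

    backward-letter : ∀ i → R.pos (inject₁ i) ≡ R.pos (suc i) ⊕ unit d → lookup w i ≡ opp d
    backward-letter i eq = letter i (opp d) (flip _ _ d eq)

    -- A node created next to `u` takes the point `u` + `d`; if the edge from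
    -- `u` to this point kept its length, that point would be taken twice.
    rigid⇒¬Split : ∀ i → pos′ (old e (suc i)) ≡ pos′ (old e (inject₁ i)) ⊕ unit (lookup w i) →
                   ¬ Split (inject₁ i) (suc i)
    rigid⇒¬Split i eq (inj₁ (q , at)) =
      old≢new e (suc i) (inject₁ i) (∈⇒Marked q) (posW-injective sep′
        (trans eq (trans (cong (λ x → pos′ (old e (inject₁ i)) ⊕ unit x) (letter i d at))
                         (sym (posW-new p e (inject₁ i) (∈⇒Marked q))))))
    rigid⇒¬Split i eq (inj₂ (q , at)) =
      old≢new e (inject₁ i) (suc i) (∈⇒Marked q) (posW-injective sep′
        (trans (flip _ _ (lookup w i) eq)
        (trans (cong (λ x → pos′ (old e (suc i)) ⊕ unit x) (trans (cong opp (backward-letter i at)) (opp-involutive d)))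
               (sym (posW-new p e (suc i) (∈⇒Marked q))))))

    right⇒Inserts : ∀ i → mark e (inject₁ i) ≡ right → Inserts (inject₁ i) (suc i)
    right⇒Inserts i r = Marked⇒∈ (cong side r) ,
      trans (R-step i) (cong (λ x → R.pos (inject₁ i) ⊕ unit x) (right-letter e i r))

    left⇒Inserts : ∀ i → mark e (suc i) ≡ left → Inserts (suc i) (inject₁ i)
    left⇒Inserts i l = Marked⇒∈ (cong side l) ,
      trans (flip _ _ (lookup w i) (R-step i))
            (cong (λ x → R.pos (suc i) ⊕ unit x) (trans (cong opp (left-letter e i l)) (opp-involutive d)))

    contribution-split : ∀ {u v} → Split u v → contribution u v ≡ R.pos v ⊖ R.pos u
    contribution-split {u} {v} s with split? u v
    ... | yes _ = refl
    ... | no ¬s = contradiction s ¬s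

    contribution-unsplit : ∀ {u v} → ¬ Split u v → contribution u v ≡ origin
    contribution-unsplit {u} {v} ¬s with split? u v
    ... | yes s = contradiction s ¬s
    ... | no _  = refl

    -- The edge is one unit long before the step and two units after it, so the displacements of its
    -- ends differ by exactly the old edge vector.
    split⇒contribution : ∀ i →
                         pos′ (old e (suc i)) ≡ pos′ (old e (inject₁ i)) ⊕ unit (lookup w i) ⊕ unit (lookup w i) →
      δ (suc i) ≡ δ (inject₁ i) ⊕ (R.pos (suc i) ⊖ R.pos (inject₁ i))
    split⇒contribution i eq rewrite eq | R-step i =
      lemma (pos′ (old e (inject₁ i))) (R.pos (inject₁ i)) (unit (lookup w i))
      where
      coord : ∀ a b c → a ℤ.+ c ℤ.+ c ℤ.- (b ℤ.+ c) ≡ a ℤ.- b ℤ.+ (b ℤ.+ c ℤ.- b)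
      coord = ℤ-Solver.solve-∀
      lemma : ∀ p q r → p ⊕ r ⊕ r ⊖ (q ⊕ r) ≡ p ⊖ q ⊕ (q ⊕ r ⊖ q)
      lemma (a , b) (c , d) (x , y) = cong₂ _,_ (coord a c x) (coord b d y)

    forward-contribution : ∀ i → δ (suc i) ≡ δ (inject₁ i) ⊕ contribution (inject₁ i) (suc i)
    forward-contribution i with stretch p e i
    ... | rigid _ _ eq rewrite contribution-unsplit (rigid⇒¬Split i eq) | eq | R-step i =
      lemma (pos′ (old e (inject₁ i))) (R.pos (inject₁ i)) (unit (lookup w i))
      where
      coord : ∀ a b c → a ℤ.+ c ℤ.- (b ℤ.+ c) ≡ a ℤ.- b ℤ.+ 0ℤ
      coord = ℤ-Solver.solve-∀
      lemma : ∀ p q r → p ⊕ r ⊖ (q ⊕ r) ≡ p ⊖ q ⊕ origin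
      lemma (a , b) (c , d) (x , y) = cong₂ _,_ (coord a c x) (coord b d y)
    ... | at-right r eq = trans (split⇒contribution i eq)
      (cong (δ (inject₁ i) ⊕_) (sym (contribution-split (inj₁ (right⇒Inserts i r)))))
    ... | at-left l eq = trans (split⇒contribution i eq)
      (cong (δ (inject₁ i) ⊕_) (sym (contribution-split (inj₂ (left⇒Inserts i l)))))

    contribution-antisym : ∀ u v → contribution v u ≡ origin ⊖ contribution u v
    contribution-antisym u v with split? u v | split? v u
    ... | yes _ | yes _ = lemma (R.pos u) (R.pos v)
      where
      coord : ∀ a b → a ℤ.- b ≡ 0ℤ ℤ.- (b ℤ.- a)
      coord = ℤ-Solver.solve-∀
      lemma : ∀ p q → p ⊖ q ≡ origin ⊖ (q ⊖ p)
      lemma (a , b) (x , y) = cong₂ _,_ (coord a x) (coord b y)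
    ... | no _  | no _  = refl
    ... | yes s | no ¬s = contradiction (swap s) ¬s
    ... | no ¬s | yes s = contradiction (swap s) ¬s

    edge-contribution : ∀ {u v} → R.Edge u v → δ v ≡ δ u ⊕ contribution u v
    edge-contribution {u} {v} uv with Equivalence.to R.edge⇔ uv
    ... | inj₁ next with i , refl , refl ← next⇒step next = forward-contribution i
    ... | inj₂ next with i , refl , refl ← next⇒step next =
      trans (move-⊕ (δ (inject₁ i)) _ (forward-contribution i))
            (cong (δ (suc i) ⊕_) (sym (contribution-antisym (inject₁ i) (suc i))))

    -- By `edge-contribution`, `δ` is a potential whose differences along edges are the
    -- contributions, so the sum telescopes along any walk, backtracking or not.
    walk-contributions : ∀ {u v} (π : Star R.Edge u v) → δ v ≡ δ u ⊕ contributions π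
    walk-contributions ε = sym (⊕-identityʳ _)
    walk-contributions {u} (_◅_ {j = v} uv π) =
      trans (walk-contributions π)
      (trans (cong (_⊕ contributions π) (edge-contribution uv)) (⊕-assoc (δ u) (contribution u v) (contributions π)))

    δ-anchor : δ (fromℕ m) ≡ origin
    δ-anchor rewrite old-last e | posW-last p w′ | R.pos-posW (fromℕ m) | posW-last p w = lemma p
      where
      lemma : ∀ p → p ⊖ p ≡ origin
      lemma (a , b) = cong₂ _,_ (ℤ.+-inverseʳ a) (ℤ.+-inverseʳ b)

    δ-displacement : IsDisplacement δ
    δ-displacement π = trans (walk-contributions π) (trans (cong (_⊕ contributions π) δ-anchor) (⊕-identityˡ _))
      where
      ⊕-identityˡ : ∀ p → origin ⊕ p ≡ p
      ⊕-identityˡ (a , b) = cong₂ _,_ (ℤ.+-identityˡ a) (ℤ.+-identityˡ b)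

    -- With c = b - a both sides become weighted sums c x + a x′ and c y + a y′. The weights are
    -- nonnegative, and one of them is positive because b is nonzero.
    convex-< : ∀ a b → .{{NonZero b}} → a ℕ.≤ b → ∀ {x x′ y y′} → x ℤ.< y → x′ ℤ.< y′ →
               (+ b) ℤ.* x ℤ.+ (+ a) ℤ.* (x′ ℤ.- x) ℤ.< (+ b) ℤ.* y ℤ.+ (+ a) ℤ.* (y′ ℤ.- y)
    convex-< a b a≤b {x} {x′} {y} {y′} x<y x′<y′ with c , refl ← ℕ.m≤n⇒∃[o]m+o≡n a≤b =
      subst₂ ℤ._<_ (sym (expand x x′)) (sym (expand y y′)) (positive a c)
      where
      coord : ∀ a c x x′ → (a ℤ.+ c) ℤ.* x ℤ.+ a ℤ.* (x′ ℤ.- x) ≡ c ℤ.* x ℤ.+ a ℤ.* x′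
      coord = ℤ-Solver.solve-∀
      expand : ∀ x x′ → (+ (a ℕ.+ c)) ℤ.* x ℤ.+ (+ a) ℤ.* (x′ ℤ.- x) ≡ (+ c) ℤ.* x ℤ.+ (+ a) ℤ.* x′
      expand = coord (+ a) (+ c)
      positive : ∀ a c → .{{NonZero (a ℕ.+ c)}} →
                 (+ c) ℤ.* x ℤ.+ (+ a) ℤ.* x′ ℤ.< (+ c) ℤ.* y ℤ.+ (+ a) ℤ.* y′
      positive a (suc c) = ℤ.+-mono-<-≤ (ℤ.*-monoˡ-<-pos (+ suc c) x<y) (ℤ.*-monoˡ-≤-nonNeg (+ a) (ℤ.<⇒≤ x′<y′))
      positive (suc a) zero = ℤ.+-mono-≤-< (ℤ.≤-refl {0ℤ}) (ℤ.*-monoˡ-<-pos (+ suc a) x′<y′)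

    dot-motion : ∀ a b u f → dot ((+ b) · R.pos u ⊕ (+ a) · δ u) (unit f)
                 ≡ (+ b) ℤ.* dot (pos u) (unit f) 
                   ℤ.+ (+ a) ℤ.* (dot (pos′ (old e u)) (unit f) ℤ.- dot (pos u) (unit f))
    dot-motion a b u f rewrite R.pos-posW u =
      trans (dot-⊕ ((+ b) · pos u) ((+ a) · (pos′ (old e u) ⊖ pos u)) (unit f))
      (cong₂ ℤ._+_ (dot-· (+ b) (pos u) (unit f))
        (trans (dot-· (+ a) (pos′ (old e u) ⊖ pos u) (unit f))
               (cong ((+ a) ℤ.*_) (dot-⊖ (pos′ (old e u)) (pos u) (unit f)))))

    -- At all times a node stays on the same side of any earlier node in the
    -- direction that separates them at the beginning and at the end.
    ordered-no-meeting : ∀ {u v} → u Fin.< v → ∀ a b → .{{NonZero b}} → a ℕ.≤ b →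
                         (+ b) · R.pos u ⊕ (+ a) · δ u ≢ (+ b) · R.pos v ⊕ (+ a) · δ v
    ordered-no-meeting {u} {v} u<v a b a≤b eq with f , lt , lt′ ← common-separator e sep sep′ u<v =
      ℤ.<-irrefl (trans (sym (dot-motion a b u f)) (trans (cong (λ q → dot q (unit f)) eq) (dot-motion a b v f)))
        (convex-< a b a≤b lt lt′)

    no-meeting : ∀ {u v} → u ≢ v → ∀ (a b : ℕ) → .{{NonZero b}} → a ℕ.≤ b →
                 (+ b) · R.pos u ⊕ (+ a) · δ u ≢ (+ b) · R.pos v ⊕ (+ a) · δ v
    no-meeting {u} {v} u≢v a b a≤b with Fin.<-cmp u v
    ... | tri< u<v _ _ = ordered-no-meeting u<v a b a≤b
    ... | tri≈ _ u≡v _ = contradiction u≡v u≢v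
    ... | tri> _ _ v<u = λ eq → ordered-no-meeting v<u a b a≤b (sym eq)

    distinct-ends : Injective _≡_ _≡_ (newPos δ)
    distinct-ends {x} {y} eq =
      trans (sym (from-to x)) (trans (cong from to-x≡to-y) (from-to y))
      where
      to-x≡to-y : to x ≡ to y
      to-x≡to-y = posW-injective sep′ (trans (sym (newPos-to x)) (trans eq (newPos-to y)))

    NewEdge-sym : Symmetric NewEdge
    NewEdge-sym (kept uv ¬s)  = kept (R.edge-sym uv) (λ s → ¬s (swap s))
    NewEdge-sym (near q)      = near-sym q
    NewEdge-sym (near-sym q)  = near q
    NewEdge-sym (far q uv x)  = far-sym q uv x
    NewEdge-sym (far-sym q uv x) = far q uv x

    Edge′ : Rel (Fin (suc m′)) 0ℓ
    Edge′ k l = Next k l ⊎ Next l k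

    Inserts-asym : ∀ {u v} → R.pos v ≡ R.pos u ⊕ unit d → R.pos u ≢ R.pos v ⊕ unit d
    Inserts-asym {u} {v} eq eq′ = x≢opp-x d (unit-injective (⊕-cancelˡ (R.pos v) (trans (sym eq′) (flip _ _ d eq))))

    kept-edge : ∀ i → ¬ Split (inject₁ i) (suc i) → Next (old e (inject₁ i)) (old e (suc i))
    kept-edge i ¬s with stretch p e i
    ... | rigid r l _    = next-old-old e i r l
    ... | at-right r _ = contradiction (inj₁ (right⇒Inserts i r)) ¬s
    ... | at-left l _  = contradiction (inj₂ (left⇒Inserts i l)) ¬s

    near-edge : ∀ u → Marked e u → Edge′ (old e u) (new e u)
    near-edge u q with mark e u in eq
    ... | left  = inj₂ (next-to-left e u eq)
    ... | right = inj₁ (next-to-right e u eq)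

    -- A marked `u` with its neighbour `v` in direction `d` forces the edge to be doubled. It cannot
    -- have been doubled from `v`, for then `u` would also lie in direction `d` from `v`.
    far-edge : ∀ {u v} → u ∈ Q → R.Edge u v → R.pos v ≡ R.pos u ⊕ unit d → Edge′ (new e u) (old e v)
    far-edge q uv at with Equivalence.to R.edge⇔ uv
    ... | inj₁ next with i , refl , refl ← next⇒step next with stretch p e i
    ...   | rigid _ _ eq   = contradiction (inj₁ (q , at)) (rigid⇒¬Split i eq)
    ...   | at-right r _ = inj₁ (next-new-old e i r)
    ...   | at-left l _  = contradiction (proj₂ (left⇒Inserts i l)) (Inserts-asym at)
    far-edge q uv at | inj₂ next with i , refl , refl ← next⇒step next with stretch p e i
    ...   | rigid _ _ eq   = contradiction (inj₂ (q , at)) (rigid⇒¬Split i eq)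
    ...   | at-right r _ = contradiction (proj₂ (right⇒Inserts i r)) (Inserts-asym at)
    ...   | at-left l _  = inj₂ (next-old-new e i l)

    newEdge⇒ : ∀ {x y} → NewEdge x y → Edge′ (to x) (to y)
    newEdge⇒ (kept uv ¬s) with Equivalence.to R.edge⇔ uv
    ... | inj₁ next with i , refl , refl ← next⇒step next = inj₁ (kept-edge i ¬s)
    ... | inj₂ next with i , refl , refl ← next⇒step next = inj₂ (kept-edge i (λ s → ¬s (swap s)))
    newEdge⇒ (near q)         = near-edge _ (∈⇒Marked q)
    newEdge⇒ (near-sym q)     = swap (near-edge _ (∈⇒Marked q))
    newEdge⇒ (far q uv at)     = far-edge q uv at
    newEdge⇒ (far-sym q uv at) = swap (far-edge q uv at)

    forget : Node → Fin (suc m) ⊎ Fin (suc m)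
    forget (inj₁ u)       = inj₁ u
    forget (inj₂ (u , _)) = inj₂ u

    origins-to : ∀ x → origins e (to x) ≡ forget x
    origins-to (inj₁ u)       = origins-old e u
    origins-to (inj₂ (u , q)) = origins-new e u (∈⇒Marked q)

    forward : ∀ i → R.Edge (inject₁ i) (suc i)
    forward i = Equivalence.from R.edge⇔ (inj₁ (step⇒next i))

    -- The equations on `forget` allow case analysis on `Consecutive`, whose indices
    -- `origins e (to x)` and `origins e (to y)` are not in constructor form.
    consecutive⇒ : ∀ {x y s t} → forget x ≡ s → forget y ≡ t → Consecutive e s t → NewEdge x y
    consecutive⇒ {inj₁ _} {inj₁ _} refl refl (old-old i r l) = kept (forward i) ¬split
      where
      ¬split : ¬ Split (inject₁ i) (suc i)
      ¬split with stretch p e i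
      ... | rigid _ _ eq    = rigid⇒¬Split i eq
      ... | at-right r′ _ = contradiction r′ r
      ... | at-left l′ _  = contradiction l′ l
    consecutive⇒ {inj₁ _} {inj₂ (_ , q)} refl refl (to-right i _) = near q
    consecutive⇒ {inj₂ (_ , q)} {inj₁ _} refl refl (to-left i _)  = near-sym q
    consecutive⇒ {inj₂ (_ , q)} {inj₁ _} refl refl (new-old i r) = far q (forward i) (proj₂ (right⇒Inserts i r))
    consecutive⇒ {inj₁ _} {inj₂ (_ , q)} refl refl (old-new i l) =
      far-sym q (R.edge-sym (forward i)) (proj₂ (left⇒Inserts i l))

    next⇒newEdge : ∀ x y → Next (to x) (to y) → NewEdge x y
    next⇒newEdge x y next with k , eq , eq′ ← next⇒step next =
      consecutive⇒ (trans (sym (origins-to x)) (cong (origins e) eq))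
                   (trans (sym (origins-to y)) (cong (origins e) eq′)) (consecutive e k)

    newEdge⇐ : ∀ x y → Edge′ (to x) (to y) → NewEdge x y
    newEdge⇐ x y (inj₁ next) = next⇒newEdge x y next
    newEdge⇐ x y (inj₂ next) = NewEdge-sym (next⇒newEdge y x next)

  expansion-step : Step R.anchored R′.anchored
  expansion-step = record
    { direction        = d
    ; operated         = Q
    ; δ                = δ
    ; δ-displacement   = δ-displacement
    ; collisionFree    = record { no-meeting = no-meeting ; distinct-ends = distinct-ends }
    ; relabel          = mk↔ₛ′ to from to-from from-to
    ; preserves-pos    = λ x → trans (R′.pos-posW (to x)) (sym (newPos-to x))
    ; preserves-edge   = λ x y → mk⇔ (λ xy → Equivalence.from R′.edge⇔ (newEdge⇒ xy))
                                     (λ xy → newEdge⇐ x y (Equivalence.to R′.edge⇔ xy))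
    ; preserves-anchor = old-last e
    }

-- Spirals given by the lengths of their runs

-- Lengths are positive by construction: `turn` carries the last letter of a run and `more` every
-- other one. The direction at `[]` is arbitrary, so the outermost run ends with `turn` like any
-- other.
data Runs (s : Sense) : Direction → List ℕ → ∀ {m} → Word m → Set where
  []   : ∀ {x} → Runs s x [] []
  turn : ∀ {x ℓs m} {w : Word m} → Runs s (rot s x) ℓs w → Runs s x (1 ∷ ℓs) (x ∷ w)
  more : ∀ {x c ℓs m} {w : Word m} → Runs s x (suc c ∷ ℓs) w → Runs s x (suc (suc c) ∷ ℓs) (x ∷ w)

-- `α` and `β` are the lengths of the two preceding runs.
data Valid : ℕ → ℕ → List ℕ → Set where
  []  : ∀ {α β} → Valid α β []
  _∷_ : ∀ {α β c ℓs} → (ℓs ≢ [] → α < c) → Valid β c ℓs → Valid α β (c ∷ ℓs)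

Valid-antitone : ∀ {α α′ β β′ ℓs} → α′ ≤ α → β′ ≤ β → Valid α β ℓs → Valid α′ β′ ℓs
Valid-antitone α≤ β≤ []      = []
Valid-antitone α≤ β≤ (g ∷ v) = (λ ≢[] → ℕ.≤-<-trans α≤ (g ≢[])) ∷ Valid-antitone β≤ ℕ.≤-refl v

-- Valid run lengths give separated words

module _ {s : Sense} where

  private
    infixl 8 _∙_
    _∙_ : Point → Direction → ℤ
    q ∙ x = dot q (unit x)

  -- `q` is `c` letters before the end of a run in direction `x`, and `b` is an
  -- earlier point.
  record Progress (b q : Point) (x sep : Direction) (c : ℕ) (ℓs : List ℕ) : Set where
    field
      {α β}   : ℕ
      ahead   : b <[ sep ] q
      forward : 0ℤ ℤ.≤ unit x ∙ sep
      lag     : ∃ λ P → P ≤ α × b ∙ rot s x ≡ q ∙ rot s x ℤ.+ + P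
      reach   : ℓs ≢ [] → ∃ λ r → suc r ≤ β × q ∙ x ℤ.+ + c ≡ b ∙ x ℤ.+ + suc r
      valid   : Valid α β ℓs

  private
    ⊕-zero : ∀ q y e → y ∙ e ≡ 0ℤ → (q ⊕ y) ∙ e ≡ q ∙ e
    ⊕-zero q y e eq = trans (dot-⊕ q y (unit e)) (trans (cong (ℤ._+_ (q ∙ e)) eq) (ℤ.+-identityʳ _))

    ⊕-one : ∀ q x → (q ⊕ unit x) ∙ x ≡ q ∙ x ℤ.+ 1ℤ
    ⊕-one q x = trans (dot-⊕ q (unit x) (unit x)) (cong (ℤ._+_ (q ∙ x)) (dot-unit-self x))

    move-one : ∀ q x c → (q ⊕ unit x) ∙ x ℤ.+ + c ≡ q ∙ x ℤ.+ + suc c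
    move-one q x c = trans (cong (ℤ._+ + c) (⊕-one q x)) (ℤ.+-assoc (q ∙ x) 1ℤ (+ c))

    ∙-rot-rot : ∀ q x → q ∙ rot s (rot s x) ≡ - (q ∙ x)
    ∙-rot-rot q x = trans (cong (q ∙_) (rot-rot s x)) (dot-unit-opp q x)

    +suc-< : ∀ a r → a ℤ.< a ℤ.+ + suc r
    +suc-< a r = subst (ℤ._< a ℤ.+ + suc r) (ℤ.+-identityʳ a) (ℤ.+-monoʳ-< a (ℤ.+<+ (s≤s z≤n)))

  -- A step along `x` loses no ground in direction `sep`, by `forward`, and leaves alone the
  -- perpendicular coordinate that `lag` measures.
  advance : ∀ {b q x sep c ℓs} → Progress b q x sep (suc c) ℓs → Progress b (q ⊕ unit x) x sep c ℓs
  advance {b} {q} {x} {sep} {c} pr = record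
    { ahead   = ℤ.<-≤-trans ahead (subst₂ ℤ._≤_ (ℤ.+-identityʳ _) (sym (dot-⊕ q (unit x) (unit sep)))
                                  (ℤ.+-monoʳ-≤ (q ∙ sep) forward))
    ; forward = forward
    ; lag     = let P , P≤ , eq = lag in P , P≤ ,
                  trans eq (cong (ℤ._+ + P) (sym (⊕-zero q (unit x) (rot s x) (dot-rotʳ s x))))
    ; reach   = λ ≢[] → let r , r≤ , eq = reach ≢[] in r , r≤ , trans (move-one q x c) eq
    ; valid   = valid
    }
    where open Progress pr

  -- Here `α` bounds the lag in the direction about to be taken, and `β` the lead just gained along
  -- `x`. The new run, if it is not the last, is longer than `α`, so it makes up the lag and ends
  -- strictly beyond `b`. The lead along `x` becomes the lag for the turn after it, which goes in
  -- direction `opp x`.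
  bend : ∀ {b q x sep c ℓs} → Progress b q x sep 0 (suc c ∷ ℓs) →
         Progress b (q ⊕ unit (rot s x)) (rot s x) x c ℓs
  bend {b} {q} {x} {sep} {c} {ℓs} pr with reach (λ ()) | lag | valid
    where open Progress pr
  ... | r , r≤ , reach-eq | P , P≤ , lag-eq | gap ∷ v = record
    { ahead   = subst (b ∙ x ℤ.<_) (sym q′x) (+suc-< (b ∙ x) r)
    ; forward = ℤ.≤-reflexive (sym (dot-rotˡ s x))
    ; lag     = suc r , r≤ , lag′
    ; reach   = λ ≢[] → reach′ (ℕ.m≤n⇒∃[o]m+o≡n (ℕ.≤-trans (s≤s P≤) (gap ≢[])))
    ; valid   = v
    }
    where
    q′ = q ⊕ unit (rot s x)
    q′x : q′ ∙ x ≡ b ∙ x ℤ.+ + suc r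
    q′x = trans (⊕-zero q (unit (rot s x)) x (dot-rotˡ s x)) (trans (sym (ℤ.+-identityʳ _)) reach-eq)
    neg : ∀ a b c → a ≡ b ℤ.+ c → - b ≡ - a ℤ.+ c
    neg a b c refl = lemma b c
      where
      lemma : ∀ b c → - b ≡ - (b ℤ.+ c) ℤ.+ c
      lemma = ℤ-Solver.solve-∀
    lag′ : b ∙ rot s (rot s x) ≡ q′ ∙ rot s (rot s x) ℤ.+ + suc r
    lag′ = trans (∙-rot-rot b x) (trans (neg (q′ ∙ x) (b ∙ x) (+ suc r) q′x)
                               (cong (ℤ._+ + suc r) (sym (∙-rot-rot q′ x))))
    reach′ : (∃ λ o → suc P + o ≡ suc c) → ∃ λ r →
             suc r ≤ suc c × q′ ∙ rot s x ℤ.+ + c ≡ b ∙ rot s x ℤ.+ + suc r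
    reach′ (o , eq) = o , s≤s (subst (o ≤_) (ℕ.suc-injective eq) (ℕ.m≤n+m o P)) ,
      trans (move-one q (rot s x) c)
      (trans (cong (λ n → q ∙ rot s x ℤ.+ + n) (trans (sym eq) (sym (ℕ.+-suc P o))))
      (trans (sym (ℤ.+-assoc (q ∙ rot s x) (+ P) (+ suc o)))
             (cong (ℤ._+ + suc o) (sym lag-eq))))

  -- What is left of a word after a letter `x` when `c` letters of the run remain.
  data Rest (x : Direction) : ℕ → List ℕ → ∀ {m} → Word m → Set where
    turned  : ∀ {ℓs m} {w : Word m} → Runs s (rot s x) ℓs w → Rest x 0 ℓs w
    ongoing : ∀ {c ℓs m} {w : Word m} → Runs s x (suc c ∷ ℓs) w → Rest x (suc c) ℓs w

  -- A walk along `w` that maintains `Progress`. A letter either continues the run, and `update`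
  -- keeps `sep`, or opens the next run, and `update` makes the finished direction `x` the
  -- separator; these are the cases of `advance` and `bend`.
  progress⇒separated : ∀ {p b x sep c ℓs m} {w : Word m} → Rest x c ℓs w →
                       Progress b (posW p w zero) x sep c ℓs →
                       ∀ i → b <[ separator x sep w i ] posW p w i
  after-advance : ∀ {p b x sep c ℓs m} {w : Word m} → Rest x c ℓs w →
                  Progress b (posW p (x ∷ w) zero) x sep (suc c) ℓs →
                  ∀ i → b <[ separator x sep (x ∷ w) (suc i) ] posW p w i
  after-bend    : ∀ {p b x sep c ℓs m} {w : Word m} → Rest (rot s x) c ℓs w →
                  Progress b (posW p (rot s x ∷ w) zero) x sep 0 (suc c ∷ ℓs) →
                  ∀ i → b <[ separator x sep (rot s x ∷ w) (suc i) ] posW p w i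

  progress⇒separated _ pr zero = Progress.ahead pr
  progress⇒separated (ongoing (turn r)) pr (suc i) = after-advance (turned r) pr i
  progress⇒separated (ongoing (more r)) pr (suc i) = after-advance (ongoing r) pr i
  progress⇒separated (turned (turn r))  pr (suc i) = after-bend (turned r) pr i
  progress⇒separated (turned (more r))  pr (suc i) = after-bend (ongoing r) pr i

  after-advance {p} {b} {x} {sep} {c} {ℓs} {w = w} r pr i rewrite update-same x sep =
    progress⇒separated r (subst (λ q → Progress b q x sep c ℓs) (sym (posW-∷ p x w)) (advance pr)) i

  after-bend {p} {b} {x} {sep} {c} {ℓs} {w = w} r pr i rewrite update-other sep (x≢rot-x s x) =
    progress⇒separated r (subst (λ q → Progress b q (rot s x) x c ℓs) (sym (posW-∷ p (rot s x) w)) (bend pr)) i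

  start : ∀ {p x c ℓs m} {w : Word m} → Valid 0 0 (suc c ∷ ℓs) →
          Progress (posW p (x ∷ w) zero) (posW p w zero) x x c ℓs
  start {p} {x} {c} {ℓs} {w = w} (_ ∷ v) = subst (λ q → Progress b q x x c ℓs) (sym (posW-∷ p x w)) record
    { ahead   = subst (b ∙ x ℤ.<_) (sym (⊕-one b x)) (+suc-< (b ∙ x) 0)
    ; forward = subst (0ℤ ℤ.≤_) (sym (dot-unit-self x)) (ℤ.+≤+ z≤n)
    ; lag     = 0 , z≤n , trans (sym (⊕-zero b (unit x) (rot s x) (dot-rotʳ s x))) (sym (ℤ.+-identityʳ _))
    ; reach   = λ _ → c , ℕ.≤-refl , move-one b x c
    ; valid   = v
    }
    where b = posW p (x ∷ w) zero

  -- Cutting off inner nodes shortens or removes the first run. As `Valid` is antitone in the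
  -- preceding lengths, every suffix is again valid and its own first node can play the part of `b`.
  runs⇒separated : ∀ {p x ℓs m} {w : Word m} → Runs s x ℓs w → Valid 0 0 ℓs → Separated p w
  runs⇒separated [] v = []
  runs⇒separated {p} (turn {w = w} r) v@(_ ∷ v′) =
    progress⇒separated (turned r) (start {p} {w = w} v) ∷ runs⇒separated r (Valid-antitone z≤n z≤n v′)
  runs⇒separated {p} (more {c = c} {w = w} r) v@(_ ∷ v′) =
    progress⇒separated (ongoing r) (start {p} {w = w} v) ∷
    runs⇒separated r ((λ _ → s≤s z≤n) ∷ Valid-antitone z≤n (ℕ.n≤1+n (suc c)) v′)

-- `c ⊑ c′` says c ≤ c′ ≤ 2c.
infix 4 _⊑_
data _⊑_ : ℕ → ℕ → Set where
  zero   : zero ⊑ zero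
  keep   : ∀ {c c′} → c ⊑ c′ → suc c ⊑ suc c′
  double : ∀ {c c′} → c ⊑ c′ → suc c ⊑ suc (suc c′)

⊑-refl : ∀ c → c ⊑ c
⊑-refl zero    = zero
⊑-refl (suc c) = keep (⊑-refl c)

⊑-+ : ∀ {a a′ b b′} → a ⊑ a′ → b ⊑ b′ → a + b ⊑ a′ + b′
⊑-+ zero       q = q
⊑-+ (keep p)   q = keep (⊑-+ p q)
⊑-+ (double p) q = double (⊑-+ p q)

-- Realising growth of the run lengths by expansions

data Axis : Set where
  along across : Axis

-- Consecutive runs are perpendicular, so a time step can change only every second length. The index
-- tells whether the first run lies on the axis of the step.
data Growth : Axis → List ℕ → List ℕ → Set where
  []  : ∀ {a} → Growth a [] []
  _∷_ : ∀ {c c′ ℓs ℓs′} → c ⊑ c′ → Growth across ℓs ℓs′ → Growth along (c ∷ ℓs) (c′ ∷ ℓs′)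
  ⟨_⟩ : ∀ {c ℓs ℓs′} → Growth along ℓs ℓs′ → Growth across (c ∷ ℓs) (c ∷ ℓs′)

module _ {s : Sense} where

  more′ : ∀ {x c ℓs m} {w : Word m} → Runs s x (c ∷ ℓs) w → Runs s x (suc c ∷ ℓs) (x ∷ w)
  more′ r@(turn _) = more r
  more′ r@(more _) = more r

  record Expanded (d : Direction) (Ok : Mark → Set) (x : Direction) (ℓs : List ℕ) {m} (w : Word m) : Set where
    constructor expanded
    field
      {size′}   : ℕ
      {word′}   : Word size′
      {first}   : Mark
      ok        : Ok first
      runs      : Runs s x ℓs word′
      expansion : Expansion d first w word′

  private
    Unmarked NotLeft : Mark → Set
    Unmarked = none ≡_
    NotLeft  = _≢ left

  -- A letter `d` is doubled by marking its inner end `right`, a letter `opp d` by marking its outer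
  -- end `left`. The condition on the first mark is what the letter in front needs: before a letter
  -- other than `opp d` it must not be `left`, and before an `opp d` that is to be doubled it must
  -- still be `none`, so that `left` can be set.
  expand-same     : ∀ {d x ℓs ℓs′ m} {w : Word m} → x ≡ d → Runs s x ℓs w → Growth along ℓs ℓs′ →
                    Expanded d NotLeft x ℓs′ w
  expand-opposite : ∀ {d x ℓs ℓs′ m} {w : Word m} → x ≡ opp d → Runs s x ℓs w →
                    Growth along ℓs ℓs′ → Expanded d Unmarked x ℓs′ w
  expand-across   : ∀ {d x ℓs ℓs′ m} {w : Word m} → rot s x ≡ d ⊎ rot s x ≡ opp d →
                    Runs s x ℓs w → Growth across ℓs ℓs′ →
                    Expanded d Unmarked x ℓs′ w

  expand-same eq [] [] = expanded (λ ()) [] end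
  expand-same refl (turn r) (keep zero ∷ g) with expanded refl r′ e ← expand-across (inj₂ (rot-rot s _)) r g =
    expanded (λ ()) (turn r′) (keep (λ ()) e)
  expand-same refl (turn r) (double zero ∷ g) with expanded refl r′ e ← expand-across (inj₂ (rot-rot s _)) r g =
    expanded (λ ()) (more (turn r′)) (right (λ ()) e)
  expand-same refl (more r) (keep c ∷ g) with expanded ok r′ e ← expand-same refl r (c ∷ g) =
    expanded (λ ()) (more′ r′) (keep (λ a≡left → contradiction a≡left ok) e)
  expand-same refl (more r) (double c ∷ g) with expanded ok r′ e ← expand-same refl r (c ∷ g) =
    expanded (λ ()) (more (more′ r′)) (right ok e)

  expand-opposite eq [] [] = expanded refl [] end
  expand-opposite {d} refl (turn r) (keep zero ∷ g)
    with expanded refl r′ e ← expand-across (inj₁ (trans (rot-rot s _) (opp-involutive d))) r g =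
    expanded refl (turn r′) (keep (λ ()) e)
  expand-opposite {d} refl (turn r) (double zero ∷ g)
    with expanded refl r′ e ← expand-across (inj₁ (trans (rot-rot s _) (opp-involutive d))) r g =
    expanded refl (more (turn r′)) (keep (λ _ → refl) (left e))
  expand-opposite refl (more r) (keep c ∷ g) with expanded refl r′ e ← expand-opposite refl r (c ∷ g) =
    expanded refl (more′ r′) (keep (λ ()) e)
  expand-opposite refl (more r) (double c ∷ g) with expanded refl r′ e ← expand-opposite refl r (c ∷ g) =
    expanded refl (more (more′ r′)) (keep (λ _ → refl) (left e))

  expand-across eq [] [] = expanded refl [] end
  expand-across (inj₁ eq) (turn r) ⟨ g ⟩ with expanded ok r′ e ← expand-same eq r g =
    expanded refl (turn r′) (keep (λ a≡left → contradiction a≡left ok) e)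
  expand-across (inj₂ eq) (turn r) ⟨ g ⟩ with expanded refl r′ e ← expand-opposite eq r g =
    expanded refl (turn r′) (keep (λ ()) e)
  expand-across eq (more r) ⟨ g ⟩ with expanded refl r′ e ← expand-across eq r ⟨ g ⟩ =
    expanded refl (more′ r′) (keep (λ ()) e)

-- The schedule

-- Identifies the word produced by the schedule with the word of the given spiral. The equality is
-- one of pairs because the sizes are not known to agree beforehand.
runs-unique : ∀ {s x ℓs m m′} {w : Word m} {w′ : Word m′} → Runs s x ℓs w → Runs s x ℓs w′ →
              _≡_ {A = ∃ Word} (m , w) (m′ , w′)
runs-unique []       []        = refl
runs-unique (turn r) (turn r′) with refl ← runs-unique r r′ = refl
runs-unique (more r) (more r′) with refl ← runs-unique r r′ = refl

runs-bounded : ∀ {s x ℓs m} {w : Word m} → Runs s x ℓs w → All (λ c → 0 < c × c ≤ m) ℓs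
runs-bounded []       = []
runs-bounded (turn r) = (s≤s z≤n , s≤s z≤n) ∷ All.map (λ (0<c , c≤m) → 0<c , ℕ.m≤n⇒m≤1+n c≤m) (runs-bounded r)
runs-bounded (more r) with (_ , c≤m) ∷ bs ← runs-bounded r =
  (s≤s z≤n , s≤s c≤m) ∷ All.map (λ (0<c , c≤m) → 0<c , ℕ.m≤n⇒m≤1+n c≤m) bs

GrowsIn-snoc : ∀ {t S S′ S″} → GrowsIn t S S′ → Step S′ S″ → GrowsIn (suc t) S S″
GrowsIn-snoc done         st = step st done
GrowsIn-snoc (step st′ g) st = step st′ (GrowsIn-snoc g st)

-- The gap of a run is the excess of its length over that of the run before the
-- previous one; the last run, whose length is free, has its length as gap.
base : ℕ → List ℕ → ℕ
base α []      = 0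
base α (_ ∷ _) = α

lengths : ℕ → ℕ → List ℕ → List ℕ
lengths α β []       = []
lengths α β (g ∷ gs) = g + base α gs ∷ lengths β (g + base α gs) gs

lengths-valid : ∀ {α β gs} → All (0 <_) gs → Valid α β (lengths α β gs)
lengths-valid []                    = []
lengths-valid (_ ∷ [])              = (λ ≢[] → contradiction refl ≢[]) ∷ []
lengths-valid {α} (0<g ∷ 0<gs@(_ ∷ _)) = (λ _ → ℕ.+-monoˡ-≤ α 0<g) ∷ lengths-valid 0<gs

gaps : ∀ {M α β ℓs} → Valid α β ℓs → All (λ c → 0 < c × c ≤ M) ℓs →
       ∃ λ gs → lengths α β gs ≡ ℓs × All (0 <_) gs × All (_≤ M) gs × length gs ≡ length ℓs
gaps [] [] = [] , refl , [] , [] , refl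
gaps {ℓs = c ∷ []} (_ ∷ []) ((0<c , c≤M) ∷ []) =
  c ∷ [] , cong (_∷ []) (ℕ.+-identityʳ c) , 0<c ∷ [] , c≤M ∷ [] , refl
gaps {α = α} {β} {ℓs = c ∷ _ ∷ _} (α<c ∷ v) ((_ , c≤M) ∷ bs) with gaps v bs
... | gs@(_ ∷ _) , eq , 0<gs , gs≤M , len =
  c ∸ α ∷ gs ,
  trans (cong (λ c → c ∷ lengths β c gs) (ℕ.m∸n+n≡m (ℕ.<⇒≤ (α<c λ ())))) (cong (c ∷_) eq) ,
  ℕ.m<n⇒0<n∸m (α<c λ ()) ∷ 0<gs , ℕ.≤-trans (ℕ.m∸n≤m c α) c≤M ∷ gs≤M , cong suc len

base-⊑ : ∀ {a gs gs′ α α′} → Growth a gs gs′ → α ⊑ α′ → base α gs ⊑ base α′ gs′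
base-⊑ []      q = zero
base-⊑ (_ ∷ _) q = q
base-⊑ ⟨ _ ⟩   q = q

base-≡ : ∀ {a gs gs′} α → Growth a gs gs′ → base α gs ≡ base α gs′
base-≡ α []      = refl
base-≡ α (_ ∷ _) = refl
base-≡ α ⟨ _ ⟩   = refl

-- Each new length is a gap plus the length two runs earlier, and `⊑` is additive. The resulting
-- relation between lengths is handed on to the next run of the same axis; lengths on the other axis
-- stay equal, by `base-≡`.
lengths-along : ∀ {α α′ β gs gs′} → α ⊑ α′ → Growth along gs gs′ →
                Growth along (lengths α β gs) (lengths α′ β gs′)
lengths-across : ∀ {α β β′ gs gs′} → β ⊑ β′ → Growth across gs gs′ →
                 Growth across (lengths α β gs) (lengths α β′ gs′)
lengths-along q [] = []
lengths-along q (c ∷ g) = ⊑-+ c (base-⊑ g q) ∷ lengths-across (⊑-+ c (base-⊑ g q)) g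
lengths-across q [] = []
lengths-across {α} q (⟨_⟩ {c} g) rewrite base-≡ α g = ⟨ lengths-along q g ⟩

lengths-growth : ∀ {a gs gs′} → Growth a gs gs′ → Growth a (lengths 0 0 gs) (lengths 0 0 gs′)
lengths-growth {along}  = lengths-along zero
lengths-growth {across} = lengths-across zero

-- A new innermost run of length 1 turns the second parameter of `lengths` from 0 into 1. With all
-- gaps 1 this lengthens by 1 every run on its axis, except the outermost run of all, whose length
-- is its gap and stays 1. One doubled letter per run suffices.
ones-along : ∀ n α β →
             Growth along (lengths α β (replicate n 1)) (lengths (suc α) β (replicate n 1))
ones-across : ∀ n α β →
              Growth across (lengths α β (replicate n 1)) (lengths α (suc β) (replicate n 1))
ones-along zero          α β = []
ones-along (suc zero)    α β = keep zero ∷ []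
ones-along (suc (suc n)) α β = double (⊑-refl α) ∷ ones-across (suc n) β (suc α)
ones-across zero          α β = []
ones-across (suc n) α β = ⟨ ones-along n β _ ⟩

halve : Axis → List ℕ → List ℕ
halve a      []       = []
halve along  (g ∷ gs) = ⌈ g /2⌉ ∷ halve across gs
halve across (g ∷ gs) = g ∷ halve along gs

⌈n/2⌉⊑n : ∀ n → ⌈ n /2⌉ ⊑ n
⌈n/2⌉⊑n zero          = zero
⌈n/2⌉⊑n (suc zero)    = keep zero
⌈n/2⌉⊑n (suc (suc n)) = double (⌈n/2⌉⊑n n)

halve-growth : ∀ a gs → Growth a (halve a gs) gs
halve-growth a      []       = []
halve-growth along  (g ∷ gs) = ⌈n/2⌉⊑n g ∷ halve-growth across gs
halve-growth across (g ∷ gs) = ⟨ halve-growth along gs ⟩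

halve-positive : ∀ a {gs} → All (0 <_) gs → All (0 <_) (halve a gs)
halve-positive a      []           = []
halve-positive along  (0<g ∷ 0<gs) = ℕ.⌈n/2⌉-mono 0<g ∷ halve-positive across 0<gs
halve-positive across (0<g ∷ 0<gs) = 0<g ∷ halve-positive along 0<gs

halve-length : ∀ a gs → length (halve a gs) ≡ length gs
halve-length a      []       = refl
halve-length along  (g ∷ gs) = cong suc (halve-length across gs)
halve-length across (g ∷ gs) = cong suc (halve-length along gs)

⌈n/2⌉≤ : ∀ {n} k → n ≤ 2 * k → ⌈ n /2⌉ ≤ k
⌈n/2⌉≤ {n} k n≤ = ℕ.≤-trans (ℕ.⌈n/2⌉-mono n≤)
  (ℕ.≤-reflexive (trans (cong (λ j → ⌈ k + j /2⌉) (ℕ.+-identityʳ k)) (sym (ℕ.n≡⌈n+n/2⌉ k))))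

-- As the axes differ, every gap is halved by exactly one of the two passes.
halve-all-bounded : ∀ a b k {gs} → a ≢ b → All (_≤ 2 * k) gs → All (_≤ k) (halve a (halve b gs))
halve-all-bounded a      b      k a≢b []       = []
halve-all-bounded along  along  k a≢b (_ ∷ _)  = contradiction refl a≢b
halve-all-bounded across across k a≢b (_ ∷ _)  = contradiction refl a≢b
halve-all-bounded along  across k a≢b (g ∷ gs) = ⌈n/2⌉≤ k g ∷ halve-all-bounded across along k (λ ()) gs
halve-all-bounded across along  k a≢b (g ∷ gs) = ⌈n/2⌉≤ k g ∷ halve-all-bounded along across k (λ ()) gs

all-ones : ∀ {gs} → All (0 <_) gs → All (_≤ 1) gs → gs ≡ replicate (length gs) 1
all-ones []           []           = refl
all-ones (0<g ∷ 0<gs) (g≤1 ∷ gs≤1) = cong₂ _∷_ (ℕ.≤-antisym g≤1 0<g) (all-ones 0<gs gs≤1)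

module _ (s : Sense) (p : Point) where

  -- A step is determined up to relabelling and fixes neither the proof components of its target nor
  -- the definition of its edges. Quantifying over all realisations lets the last step end at the
  -- given path shape itself.
  record Grown (t : ℕ) (x : Direction) (ℓs : List ℕ) : Set₁ where
    constructor grown
    field
      {size} : ℕ
      {word} : Word size
      runs   : Runs s x ℓs word
      grows  : (R : Realisation p word) → GrowsIn t (singleNode p) (Realisation.anchored R)

  grow-expanded : ∀ {d a t x x′ ℓs ℓs′ m m′} {w : Word m} {w′ : Word m′} → Expansion d a w w′ →
                  Valid 0 0 ℓs → Valid 0 0 ℓs′ → Runs s x ℓs w → Runs s x′ ℓs′ w′ →
                  ((R : Realisation p w) → GrowsIn t (singleNode p) (Realisation.anchored R)) →
                  Grown (suc t) x′ ℓs′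
  grow-expanded {w = w} {w′} e v v′ r r′ grows = grown r′ λ R′ →
    GrowsIn-snoc (grows (path-realisation (wordPath sep) λ _ → refl))
                 (expansion-step e sep (runs⇒separated r′ v′) (path-realisation (wordPath sep) λ _ → refl) R′)
    where
    sep : Separated p w
    sep = runs⇒separated r v

  grow-lengths : ∀ {a t x ℓs ℓs′} → Growth a ℓs ℓs′ → Valid 0 0 ℓs → Valid 0 0 ℓs′ →
                 Grown t x ℓs → Grown (suc t) x ℓs′
  grow-lengths {along}  g v v′ (grown r grows) with expanded _ r′ e ← expand-same refl r g =
    grow-expanded e v v′ r r′ grows
  grow-lengths {across} g v v′ (grown r grows) with expanded _ r′ e ← expand-across (inj₁ refl) r g =
    grow-expanded e v v′ r r′ grows

  -- The node created at the internal endpoint lies in direction `opp x` from it, so the new edge,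
  -- read outwards, is a letter `x`. The run after it is perpendicular; expanding it leaves the
  -- endpoint unmarked, as `left` demands, while the same step lengthens the runs on the axis of
  -- `x`.
  grow-inwards : ∀ {t x ℓs ℓs′} → Growth across ℓs ℓs′ → Valid 0 0 ℓs → Valid 0 0 (1 ∷ ℓs′) →
                 Grown t (rot s x) ℓs → Grown (suc t) x (1 ∷ ℓs′)
  grow-inwards {x = x} g v v′ (grown r grows) with expanded refl r′ e ← expand-across (inj₁ (rot-rot s x)) r g =
    grow-expanded (subst (λ y → Expansion (opp x) left _ (y ∷ _)) (opp-involutive x) (left e)) v v′ r (turn r′) grows

  ones-positive : ∀ n → All (0 <_) (replicate n 1)
  ones-positive zero    = []
  ones-positive (suc n) = s≤s z≤n ∷ ones-positive n

  grow-ones : ∀ n x → Grown (suc n) x (lengths 0 0 (replicate (suc n) 1))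
  -- The induction starts after one step: with none, the target would have to be `singleNode p`
  -- itself instead of an arbitrary realisation.
  grow-ones zero x = grown (turn []) λ R →
    step (expansion-step (subst (λ y → Expansion (opp x) left [] (y ∷ [])) (opp-involutive x) (left end))
                         [] (runs⇒separated {s} (turn []) (lengths-valid (ones-positive 1)))
                         (singleNode-realisation p) R) done
  grow-ones (suc n) x =
    grow-inwards (ones-across (suc n) 0 0) (lengths-valid (ones-positive (suc n)))
                 (lengths-valid (ones-positive (suc (suc n)))) (grow-ones n (rot s x))

  grow-gaps : ∀ T n x gs → length gs ≡ suc n → All (0 <_) gs → All (_≤ 2 ^ T) gs →
              Grown (T * 2 + suc n) x (lengths 0 0 gs)
  grow-gaps zero n x gs len 0<gs gs≤ =
    subst (λ gs → Grown (suc n) x (lengths 0 0 gs))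
          (sym (trans (all-ones 0<gs gs≤) (cong (λ k → replicate k 1) len))) (grow-ones n x)
  grow-gaps (suc T) n x gs len 0<gs gs≤ =
    grow-lengths (lengths-growth (halve-growth along gs)) (lengths-valid 0<gs₁) (lengths-valid 0<gs)
    (grow-lengths (lengths-growth (halve-growth across gs₁)) (lengths-valid 0<gs₂) (lengths-valid 0<gs₁)
    (grow-gaps T n x gs₂ (trans (halve-length across gs₁) (trans (halve-length along gs) len)) 0<gs₂
               (halve-all-bounded across along (2 ^ T) (λ ()) gs≤)))
    where
    gs₁ = halve along gs
    gs₂ = halve across gs₁
    0<gs₁ = halve-positive along 0<gs
    0<gs₂ = halve-positive across 0<gs₁

  -- No gap exceeds the length of its run, and no run exceeds the `m` edges of the path, so `T`
  -- rounds of halving bring every gap down to 1.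
  grow-runs : ∀ {x c ℓs m} {w : Word m} T → m ≤ 2 ^ T → Runs s x (c ∷ ℓs) w → Valid 0 0 (c ∷ ℓs) →
              (R : Realisation p w) →
                   GrowsIn (T * 2 + suc (length ℓs)) (singleNode p) (Realisation.anchored R)
  grow-runs {x} {c} {ℓs} T m≤ r v R with gaps v (runs-bounded r)
  ... | gs , eq , 0<gs , gs≤m , len
    with grown r′ grows ← subst (Grown _ x) eq
           (grow-gaps T (length ℓs) x gs len 0<gs (All.map (λ g≤m → ℕ.≤-trans g≤m m≤) gs≤m))
    with refl ← runs-unique r r′ = grows R

n<2^[1+⌊log₂n⌋] : ∀ n → n < 2 ^ suc ⌊log₂ n ⌋
n<2^[1+⌊log₂n⌋] n = ℕ.≰⇒> λ 2^≤n →
  ℕ.1+n≰n (subst (_≤ ⌊log₂ n ⌋) (⌊log₂[2^n]⌋≡n (suc ⌊log₂ n ⌋)) (⌊log₂⌋-mono-≤ 2^≤n))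

-- The run lengths of a spiral

adjacent⇒unit : ∀ p q → Adjacent p q → ∃ λ x → q ≡ p ⊕ unit x
adjacent⇒unit p@(a , b) q@(c , d) adj = from-difference (unit-of (a ℤ.- c) (b ℤ.- d) adj)
  where
  unit-of : ∀ i j → ∣ i ∣ + ∣ j ∣ ≡ 1 → ∃ λ x → unit x ≡ origin ⊖ (i , j)
  unit-of (+ 0)      (+ 1)      _ = south , refl
  unit-of (+ 0)      (-[1+ 0 ]) _ = north , refl
  unit-of (+ 1)      (+ 0)      _ = west , refl
  unit-of (-[1+ 0 ]) (+ 0)      _ = east , refl
  from-difference : (∃ λ x → unit x ≡ origin ⊖ (p ⊖ q)) → ∃ λ x → q ≡ p ⊕ unit x
  from-difference (x , eq) = x , trans (move-⊕ q (p ⊖ q) (sym (⊕-⊖-cancel q p))) (cong (p ⊕_) (sym eq))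

parallel : ∀ x y → dot (unit x) (unit y) ≢ 0ℤ → y ≡ x ⊎ y ≡ opp x
parallel north north _ = inj₁ refl
parallel north east  ≢0 = contradiction refl ≢0
parallel north south _ = inj₂ refl
parallel north west  ≢0 = contradiction refl ≢0
parallel east  north ≢0 = contradiction refl ≢0
parallel east  east  _ = inj₁ refl
parallel east  south ≢0 = contradiction refl ≢0
parallel east  west  _ = inj₂ refl
parallel south north _ = inj₂ refl
parallel south east  ≢0 = contradiction refl ≢0
parallel south south _ = inj₁ refl
parallel south west  ≢0 = contradiction refl ≢0
parallel west  north ≢0 = contradiction refl ≢0
parallel west  east  _ = inj₂ refl
parallel west  south ≢0 = contradiction refl ≢0
parallel west  west  _ = inj₁ refl

tailPath : ∀ {m} → Path (suc (suc m)) → Path (suc m)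
tailPath P = record
  { node           = node ∘ suc
  ; node-injective = Fin.suc-injective ∘ node-injective
  ; next-adjacent  = next-adjacent ∘ cong suc
  }
  where open Path P

tailBend : ∀ {m} (P : Path (suc (suc m))) {h i j} → Path.Bend (tailPath P) h i j →
           Path.Bend P (suc h) (suc i) (suc j)
tailBend P (hi , ij , ⟂) = cong suc hi , cong suc ij , ⟂

tailSpiral : ∀ {m} → Spiral (suc (suc m)) → Spiral (suc m)
tailSpiral P = record
  { path      = tailPath path
  ; sense     = sense
  ; one-sense = one-sense ∘ tailBend path
  ; outward   = λ b g<i → outward (tailBend path b) (s≤s g<i)
  }
  where open Spiral P

difference : ∀ {p q} x → q ≡ p ⊕ unit x → q ⊖ p ≡ unit x
difference {p} x refl = p⊕q⊖p≡q p (unit x)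

next-letter : ∀ {m} (P : Spiral (suc (suc (suc m)))) → let open Spiral P in ∀ x y →
              node (suc zero) ≡ node zero ⊕ unit x → node (suc (suc zero)) ≡ node (suc zero) ⊕ unit y →
              y ≡ x ⊎ y ≡ rot sense x
next-letter P x y eq₀ eq₁ with dot (unit x) (unit y) ℤ.≟ 0ℤ
... | yes ⟂ = inj₂ (unit-injective (begin
    unit y                                     ≡⟨ difference y eq₁ ⟨
    node (suc (suc zero)) ⊖ node (suc zero)    ≡⟨ one-sense bend₁ ⟩
    rotate sense (node (suc zero) ⊖ node zero) ≡⟨ cong (rotate sense) (difference x eq₀) ⟩
    rotate sense (unit x)                      ≡⟨ unit-rot sense x ⟨
    unit (rot sense x)                         ∎))
  where
  open Spiral P
  open ≡-Reasoning
  bend₁ : Bend zero (suc zero) (suc (suc zero))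
  bend₁ = refl , refl , trans (cong₂ dot (difference x eq₀) (difference y eq₁)) ⟂
... | no ¬⟂ = forward (parallel x y ¬⟂)
  where
  open Spiral P
  forward : y ≡ x ⊎ y ≡ opp x → y ≡ x ⊎ y ≡ rot sense x
  forward (inj₁ y≡x)  = inj₁ y≡x
  -- A reversal would lead back to the first node.
  forward (inj₂ refl) = contradiction (node-injective back) λ ()
    where
    back : node (suc (suc zero)) ≡ node zero
    back = trans eq₁ (trans (cong (node (suc zero) ⊕_) (unit-opp x)) (sym (move-⊕ (node zero) (unit x) eq₀)))

cons-run : ∀ {s x y ℓs m} {w : Word m} → y ≡ x ⊎ y ≡ rot s x → ℓs ≢ [] → Runs s y ℓs w →
           ∃ λ ℓs′ → Runs s x ℓs′ (x ∷ w)
cons-run {ℓs = []}     _           ≢[] _ = contradiction refl ≢[]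
cons-run {ℓs = c ∷ ℓs} (inj₁ refl) _ r = suc c ∷ ℓs , more′ r
cons-run {ℓs = ℓs}     (inj₂ refl) _ r = 1 ∷ ℓs , turn r

cons-posW : ∀ {m} (f : Fin (suc (suc m)) → Point) {p} {w : Word m} x →
            f (suc zero) ≡ f zero ⊕ unit x →
            (∀ i → f (suc i) ≡ posW p w i) → ∀ i → f i ≡ posW p (x ∷ w) i
cons-posW f {p} {w} x eq₀ eq zero =
  trans (move-⊕ (f zero) (unit x) eq₀)
  (trans (cong (_⊕ (origin ⊖ unit x)) (eq zero)) (⊕-neg (posW p w zero) (unit x)))
  where
  ⊕-neg : ∀ p q → p ⊕ (origin ⊖ q) ≡ p ⊖ q
  ⊕-neg (a , b) (c , d) = cong₂ _,_ (lemma a c) (lemma b d)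
    where
    lemma : ∀ a c → a ℤ.+ (0ℤ ℤ.- c) ≡ a ℤ.- c
    lemma = ℤ-Solver.solve-∀
cons-posW f x eq₀ eq (suc i) = eq i

Decoding : ∀ {m} → Spiral (suc m) → Set
Decoding {m} P = ∃₂ λ x ℓs → ∃ λ (w : Word m) →
  Runs (Spiral.sense P) x ℓs w × ∀ i → Spiral.node P i ≡ posW (Spiral.node P (fromℕ m)) w i

decode-cons : ∀ {m} (P : Spiral (suc (suc m))) x →
              Spiral.node P (suc zero) ≡ Spiral.node P zero ⊕ unit x →
              Decoding (tailSpiral P) → Decoding P
decode-cons {zero} P x eq₀ (y , ℓs , [] , r , eq) =
  x , 1 ∷ [] , x ∷ [] , turn [] , cons-posW (Spiral.node P) x eq₀ eq
decode-cons {suc m} P x eq₀ (y , ℓs , z ∷ w , r , eq) =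
  x , proj₁ runs , x ∷ z ∷ w , proj₂ runs , cons-posW node x eq₀ eq
  where
  open Spiral P
  p = node (fromℕ (suc (suc m)))
  eq₁ : node (suc (suc zero)) ≡ node (suc zero) ⊕ unit z
  eq₁ = trans (eq (suc zero)) (trans (posW-∷ p z w) (cong (_⊕ unit z) (sym (eq zero))))
  first : ∀ {ℓs m} {w : Word m} → Runs sense y ℓs (z ∷ w) → z ≡ y × ℓs ≢ []
  first (turn _) = refl , λ ()
  first (more _) = refl , λ ()
  runs : ∃ λ ℓs′ → Runs sense x ℓs′ (x ∷ z ∷ w)
  runs with refl , ℓs≢[] ← first r = cons-run (next-letter P x y eq₀ eq₁) ℓs≢[] r

decode : ∀ {m} (P : Spiral (suc m)) → Decoding P
-- Without letters the direction is arbitrary; `north` is a default.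
decode {zero}  P = north , [] , [] , [] , λ { zero → refl }
decode {suc m} P = decode-cons P (proj₁ letter) (proj₂ letter) (decode (tailSpiral P))
  where
  open Spiral P
  letter = adjacent⇒unit (node zero) (node (suc zero)) (next-adjacent refl)

-- `Q` holds of every bend of the word and of the direction in which it is reached.
AtTurns : ∀ {s x ℓs m} {w : Word m} → Runs s x ℓs w → (Fin (suc m) → Direction → Set) → Set
AtTurns []                     Q = ⊤
AtTurns (turn {x} {ℓs} r)      Q = (ℓs ≢ [] → Q (suc zero) x) × AtTurns r (Q ∘ suc)
AtTurns (more r)               Q = AtTurns r (Q ∘ suc)

word-difference : ∀ {m p} (f : Fin (suc (suc m)) → Point) {x} {w : Word m} →
                  (∀ i → f i ≡ posW p (x ∷ w) i) → f (suc zero) ⊖ f zero ≡ unit x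
word-difference {p = p} f {x} {w} eq =
  difference x (trans (eq (suc zero)) (trans (posW-∷ p x w) (cong (_⊕ unit x) (sym (eq zero)))))

first-bend : ∀ {s x ℓs m p} {w : Word m} → Runs s (rot s x) ℓs w → ℓs ≢ [] →
             (P : Path (suc (suc m))) → let open Path P in
             (∀ i → node i ≡ posW p (x ∷ w) i) → ∃ λ j → Bend zero (suc zero) j
first-bend [] ℓs≢[] P eq = contradiction refl ℓs≢[]
first-bend {s} {x} (turn r) _ P eq = suc (suc zero) , refl , refl ,
  trans (cong₂ dot (word-difference (Path.node P) eq) (word-difference (Path.node P ∘ suc) (eq ∘ suc))) (dot-rotʳ s x)
first-bend {s} {x} (more r) _ P eq = suc (suc zero) , refl , refl ,
  trans (cong₂ dot (word-difference (Path.node P) eq) (word-difference (Path.node P ∘ suc) (eq ∘ suc))) (dot-rotʳ s x)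

atTurns : ∀ {s x ℓs m p} {w : Word m} (r : Runs s x ℓs w) (P : Path (suc m)) → let open Path P in
          (∀ i → node i ≡ posW p w i) → (Q : Fin (suc m) → Direction → Set) →
          (∀ {h i j x} → Bend h i j → node i ⊖ node h ≡ unit x → Q i x) → AtTurns r Q
atTurns []       P eq Q q = tt
atTurns (turn r) P eq Q q =
  (λ ℓs≢[] → q (proj₂ (first-bend r ℓs≢[] P eq)) (word-difference (Path.node P) eq)) ,
  atTurns r (tailPath P) (eq ∘ suc) (Q ∘ suc) (q ∘ tailBend P)
atTurns (more r) P eq Q q = atTurns r (tailPath P) (eq ∘ suc) (Q ∘ suc) (q ∘ tailBend P)

Outward : Point → Point → ∀ {s x ℓs m} {w : Word m} → Runs s x ℓs w → Set
Outward p b {w = w} r = AtTurns r λ i x → b <[ x ] posW p w i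

-- The situation after the first run, in a form that can be iterated: `outward⇒<` passes three runs
-- with the same `b`.
record RunEnd (p b : Point) (s : Sense) (x : Direction) (ℓs : List ℕ) (q : Point) : Set where
  field
    {size}  : ℕ
    {word}  : Word size
    runs    : Runs s (rot s x) ℓs word
    outward : Outward p b runs
    beyond  : ℓs ≢ [] → b <[ x ] posW p word zero
    at      : posW p word zero ≡ q

private
  one-more : ∀ q c x → q ⊕ unit x ⊕ (+ c) · unit x ≡ q ⊕ (+ suc c) · unit x
  one-more (a , b) c x = cong₂ _,_ (lemma a (+ c) (proj₁ (unit x))) (lemma b (+ c) (proj₂ (unit x)))
    where
    lemma : ∀ a c x → a ℤ.+ x ℤ.+ c ℤ.* x ≡ a ℤ.+ (1ℤ ℤ.+ c) ℤ.* x
    lemma = ℤ-Solver.solve-∀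

runEnd : ∀ {p b s x c ℓs m} {w : Word m} (r : Runs s x (c ∷ ℓs) w) → Outward p b r →
         RunEnd p b s x ℓs (posW p w zero ⊕ (+ c) · unit x)
runEnd {p} {b} {x = x} (turn {w = w} r) (beyond , outward) = record
  { runs    = r
  ; outward = outward
  ; beyond  = beyond
  ; at      = trans (posW-∷ p x w) (cong (posW p (x ∷ w) zero ⊕_) (sym (1·unit x)))
  }
  where
  1·unit : ∀ x → 1ℤ · unit x ≡ unit x
  1·unit north = refl
  1·unit east  = refl
  1·unit south = refl
  1·unit west  = refl
runEnd {p} {b} {x = x} (more {c = c} {w = w} r) outward = record
  { runs    = runs
  ; outward = outward′
  ; beyond  = beyond
  ; at      = trans at (trans (cong (_⊕ (+ suc c) · unit x) (posW-∷ p x w))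
                     (one-more (posW p (x ∷ w) zero) (suc c) x))
  }
  where open RunEnd (runEnd {p} {b} r outward) renaming (outward to outward′)

-- In direction `y`, which is `opp x`, the first run loses `a`, the second is perpendicular and the
-- third gains `c`. At the turn that ends the third run the path must be beyond its internal
-- endpoint in this direction, so c - a is positive.
outward⇒< : ∀ {p s x a b c ℓs m} {w : Word m} (r : Runs s x (a ∷ b ∷ c ∷ ℓs) w) →
            Outward p (posW p w zero) r → ℓs ≢ [] → a < c
outward⇒< {p} {s} {x} {a} {b} {c} {w = w} r out ℓs≢[] =
  ℤ.drop‿+<+ (subst₂ ℤ._<_ (cancel k (+ a)) (cancel′ k (+ a) (+ c))
    (ℤ.+-monoˡ-< ((+ a) ℤ.- k) (subst (k ℤ.<_) coordinate (beyond₃ ℓs≢[]))))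
  where
  q = posW p w zero
  y = rot s (rot s x)
  k = dot q (unit y)
  open RunEnd (runEnd {p} {q} r out) renaming (runs to r₁; outward to out₁; at to at₁)
  open RunEnd (runEnd {p} {q} r₁ out₁) using () renaming (runs to r₂; outward to out₂; at to at₂)
  open RunEnd (runEnd {p} {q} r₂ out₂) using () renaming (beyond to beyond₃; at to at₃)
  cancel : ∀ k a → k ℤ.+ (a ℤ.- k) ≡ a
  cancel = ℤ-Solver.solve-∀
  cancel′ : ∀ k a c → k ℤ.+ (c ℤ.- a) ℤ.+ (a ℤ.- k) ≡ c
  cancel′ = ℤ-Solver.solve-∀
  coordinate : dot (posW p (RunEnd.word (runEnd {p} {q} r₂ out₂)) zero) (unit y)
             ≡ dot q (unit y) ℤ.+ ((+ c) ℤ.- (+ a))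
  coordinate = begin
    dot (posW p (RunEnd.word (runEnd {p} {q} r₂ out₂)) zero) (unit y)
      ≡⟨ cong (λ q → dot q (unit y)) (trans at₃ (cong (_⊕ (+ c) · unit y)
           (trans at₂ (cong (_⊕ (+ b) · unit (rot s x)) at₁)))) ⟩
    dot (q ⊕ (+ a) · unit x ⊕ (+ b) · unit (rot s x) ⊕ (+ c) · unit y) (unit y)
      ≡⟨ along-y (q ⊕ (+ a) · unit x ⊕ (+ b) · unit (rot s x)) c y (dot-unit-self y) ⟩
    dot (q ⊕ (+ a) · unit x ⊕ (+ b) · unit (rot s x)) (unit y) ℤ.+ (+ c) ℤ.* 1ℤ
      ≡⟨ cong (ℤ._+ (+ c) ℤ.* 1ℤ) (along-y (q ⊕ (+ a) · unit x) b (rot s x) (dot-rotʳ s (rot s x))) ⟩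
    dot (q ⊕ (+ a) · unit x) (unit y) ℤ.+ (+ b) ℤ.* 0ℤ ℤ.+ (+ c) ℤ.* 1ℤ
      ≡⟨ cong (λ k → k ℤ.+ (+ b) ℤ.* 0ℤ ℤ.+ (+ c) ℤ.* 1ℤ) (along-y q a x x·y) ⟩
    dot q (unit y) ℤ.+ (+ a) ℤ.* (- 1ℤ) ℤ.+ (+ b) ℤ.* 0ℤ ℤ.+ (+ c) ℤ.* 1ℤ
      ≡⟨ simplify (dot q (unit y)) (+ a) (+ b) (+ c) ⟩
    dot q (unit y) ℤ.+ ((+ c) ℤ.- (+ a)) ∎
    where
    open ≡-Reasoning
    along-y : ∀ q k z {v} → dot (unit z) (unit y) ≡ v →
              dot (q ⊕ (+ k) · unit z) (unit y) ≡ dot q (unit y) ℤ.+ (+ k) ℤ.* v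
    along-y q k z refl = trans (dot-⊕ q ((+ k) · unit z) (unit y))
                               (cong (ℤ._+_ (dot q (unit y))) (dot-· (+ k) (unit z) (unit y)))
    x·y : dot (unit x) (unit y) ≡ - 1ℤ
    x·y = trans (cong (dot (unit x) ∘ unit) (rot-rot s x)) (trans (dot-unit-opp (unit x) x) (cong -_ (dot-unit-self x)))
    simplify : ∀ k a b c → k ℤ.+ a ℤ.* (- 1ℤ) ℤ.+ b ℤ.* 0ℤ ℤ.+ c ℤ.* 1ℤ ≡ k ℤ.+ (c ℤ.- a)
    simplify = ℤ-Solver.solve-∀

Valid-cons : ∀ {a ℓs} → (∀ {b c ℓs′} → ℓs ≡ b ∷ c ∷ ℓs′ → ℓs′ ≢ [] → a < c) → Valid 0 0 ℓs →
             Valid 0 a ℓs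
Valid-cons a<c []            = []
Valid-cons a<c (g ∷ [])      = g ∷ []
Valid-cons a<c (g ∷ (_ ∷ v)) = g ∷ (a<c refl ∷ v)

spiral-outward : ∀ {m p x ℓs} {w : Word m} (P : Spiral (suc m)) (r : Runs (Spiral.sense P) x ℓs w) →
                 (∀ i → Spiral.node P i ≡ posW p w i) → Outward p (posW p w zero) r
spiral-outward {p = p} {w = w} P r eq = atTurns r path eq _ beyond
  where
  open Spiral P
  beyond : ∀ {h i j x} → Bend h i j → node i ⊖ node h ≡ unit x → posW p w zero <[ x ] posW p w i
  beyond {h} {i} b diff =
    subst₂ ℤ._<_ (cong₂ dot (eq zero) diff) (cong₂ dot (eq i) diff)
      (outward b (subst (0 <_) (sym (proj₁ b)) (s≤s z≤n)))

-- The tail of a spiral is a spiral, so the induction settles all inequalities that do not involve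
-- the first run. That run constrains only the third, and `outward⇒<` from the current internal
-- endpoint gives the inequality for its full length.
spiral-valid : ∀ {m p x ℓs} {w : Word m} (P : Spiral (suc m)) → Runs (Spiral.sense P) x ℓs w →
               (∀ i → Spiral.node P i ≡ posW p w i) → Valid 0 0 ℓs
spiral-valid P [] eq = []
spiral-valid {p = p} P r@(turn r′) eq =
  (λ _ → s≤s z≤n) ∷ Valid-cons (λ { refl → outward⇒< {p} r (spiral-outward P r eq) })
                               (spiral-valid (tailSpiral P) r′ (eq ∘ suc))
spiral-valid {p = p} P r@(more r′) eq with _ ∷ v ← spiral-valid (tailSpiral P) r′ (eq ∘ suc) =
  (λ _ → s≤s z≤n) ∷ Valid-cons (λ { refl → outward⇒< {p} r (spiral-outward P r eq) })
                               (Valid-antitone z≤n z≤n v)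

-- Counting turning points, and the time bound

module _ {A : Set} {Q : A → Set} (Q? : Decidable Q) where

  length-filter-∷ : ∀ y ys → length (filter Q? ys) ≤ length (filter Q? (y ∷ ys))
  length-filter-∷ y ys with Q? y
  ... | yes _ = ℕ.n≤1+n _
  ... | no  _ = ℕ.≤-refl

  length-filter-accept : ∀ {y} ys → Q y → length (filter Q? (y ∷ ys)) ≡ suc (length (filter Q? ys))
  length-filter-accept ys q = cong length (filter-accept Q? q)

  turns≤ : ∀ {s x c ℓs m} {w : Word m} (r : Runs s x (c ∷ ℓs) w) (f : Fin (suc m) → A) →
           AtTurns r (λ i _ → Q (f i)) →
           length ℓs ≤ length (filter Q? (List.tabulate (f ∘ suc)))
  turns≤ (turn [])         f q = z≤n
  turns≤ {ℓs = _ ∷ ℓs} (turn r@(turn _)) f (q , qs) =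
    subst (suc (length ℓs) ≤_) (sym (length-filter-accept (List.tabulate (λ i → f (suc (suc i)))) (q λ ())))
          (s≤s (turns≤ r (f ∘ suc) qs))
  turns≤ {ℓs = _ ∷ ℓs} (turn r@(more _)) f (q , qs) =
    subst (suc (length ℓs) ≤_) (sym (length-filter-accept (List.tabulate (λ i → f (suc (suc i)))) (q λ ())))
          (s≤s (turns≤ r (f ∘ suc) qs))
  turns≤ (more r@(turn _)) f qs = ℕ.≤-trans (turns≤ r (f ∘ suc) qs) (length-filter-∷ _ _)
  turns≤ (more r@(more _)) f qs = ℕ.≤-trans (turns≤ r (f ∘ suc) qs) (length-filter-∷ _ _)

-- The internal endpoint accounts for the first run, and the bend at which it begins for each later
-- run.
runs≤turningPoints : ∀ {m s p x c ℓs} {w : Word m} (P : Path (suc m)) → Runs s x (c ∷ ℓs) w →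
                     (∀ i → Path.node P i ≡ posW p w i) →
                     suc (length ℓs) ≤ length (Path.turningPoints P)
runs≤turningPoints {ℓs = ℓs} P r eq =
  subst (suc (length ℓs) ≤_) (sym (length-filter-accept turningPoint? (List.tabulate suc) (inj₁ refl)))
    (s≤s (turns≤ turningPoint? r id (atTurns r P eq _ λ b _ → inj₂ (inj₂ (_ , _ , b)))))
  where open Path P

-- Since `L` is at least 1, the 2 (L + 1) steps of the doubling rounds are at most 4 L, whence the
-- 4. The other `c * L` covers the phase that adds one run per step.
time-bound : ∀ c {L n} → 1 ≤ L → n ≤ c * L → suc L * 2 + n ≤ (4 + c) * L
time-bound c {L} {n} 1≤L n≤ = begin
  suc L * 2 + n       ≤⟨ ℕ.+-mono-≤ (ℕ.*-monoˡ-≤ 2 (ℕ.+-monoˡ-≤ L 1≤L)) n≤ ⟩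
  (L + L) * 2 + c * L ≡⟨ lemma L c ⟩
  (4 + c) * L         ∎
  where
  open ℕ.≤-Reasoning
  lemma : ∀ L c → (L + L) * 2 + c * L ≡ (4 + c) * L
  lemma = ℕ-Solver.solve-∀

theorem3p3 : (c : ℕ) → ∃ λ (C : ℕ) →
    (m : ℕ) (P : Spiral (suc m)) →
    length (Spiral.turningPoints P) ≤ c * ⌊log₂ suc m ⌋ →
    ∃ λ (t : ℕ) → t ≤ C * ⌊log₂ suc m ⌋ ×
    GrowsIn t (singleNode (Spiral.node P (externalEndpoint P))) (anchoredAtExternal P)
theorem3p3 c = 4 + c , grow
  where
  grow : ∀ m (P : Spiral (suc m)) → length (Spiral.turningPoints P) ≤ c * ⌊log₂ suc m ⌋ →
         ∃ λ t → t ≤ (4 + c) * ⌊log₂ suc m ⌋ ×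
         GrowsIn t (singleNode (Spiral.node P (externalEndpoint P))) (anchoredAtExternal P)
  grow m P few with decode P
  -- For a single node the logarithm is 0, but the node is a turning point, so the bound on turning
  -- points is violated.
  ... | _ , [] , _ , [] , _ =
    contradiction (subst₂ _≤_ (length-filter-accept (Spiral.turningPoint? P) [] (inj₁ refl))
                              (ℕ.*-zeroʳ c) few) λ ()
  ... | x , k ∷ ℓs , w , r , eq =
    suc L * 2 + suc (length ℓs) ,
    time-bound c 1≤L (ℕ.≤-trans (runs≤turningPoints path r eq) few) ,
    grow-runs sense (node (externalEndpoint P)) (suc L)
      (ℕ.<⇒≤ (ℕ.<-trans (ℕ.n<1+n m) (n<2^[1+⌊log₂n⌋] (suc m))))
      r (spiral-valid P r eq) (path-realisation path eq)
    where
    open Spiral P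
    L = ⌊log₂ suc m ⌋
    1≤m : 1 ≤ m
    1≤m with (0<k , k≤m) ∷ _ ← runs-bounded r = ℕ.≤-trans 0<k k≤m
    1≤L : 1 ≤ L
    1≤L = subst (_≤ L) (⌊log₂[2^n]⌋≡n 1) (⌊log₂⌋-mono-≤ (s≤s 1≤m))
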